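{- Let $A\in\mathbb{F}_2[x]$ be bi-unitary perfect with $\omega(A)=3$. Then $A\in\{C_1,\dots,C_7\}$ or $\overline{A}\in\{C_1,\dots,C_7\}$, where $C_1=x^3(x+1)^4M_1$, $C_2=x^3(x+1)^5M_1^2$, $C_3=x^4(x+1)^4M_1^2$, $C_4=x^6(x+1)^6M_1^2$, $C_5=x^4(x+1)^5M_1^3$, $C_6=x^7(x+1)^8M_5$, $C_7=x^7(x+1)^9M_5^2$.
   Context: All polynomials are in $\mathbb{F}_2[x]$. For nonzero $S$, a divisor $D$ of $S$ is unitary if $\gcd(D,S/D)=1$; $\gcd_u(S,T)$ denotes the greatest common unitary divisor of $S$ and $T$. A divisor $D$ of $S$ is bi-unitary if $\gcd_u(D,S/D)=1$. $\sigma^{**}(S)$ denotes the sum of all bi-unitary divisors of $S$, and $S$ is bi-unitary perfect if $\sigma^{**}(S)=S$. $\omega(S)$ is the number of distinct irreducible factors of $S$. For $S\in\mathbb{F}_2[x]$, $\overline{S}(x)=S(x+1)$. $M_1=1+x+x^2$, $M_4=1+x+x^2+x^3+x^4$, $M_5=1+x^3+x^4$. -}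

module Defs where

open import Data.Bool using (Bool; true; false; not; _xor_)
open import Data.Nat using (ℕ; zero; suc)
open import Data.List using (List; []; _∷_; foldr; length)
open import Data.List.Membership.Propositional using (_∈_)
open import Data.List.Relation.Unary.Unique.Propositional using (Unique)
open import Data.Product using (Σ; ∃; _×_; _,_)
open import Data.Sum using (_⊎_)
open import Relation.Binary.PropositionalEquality using (_≡_; _≢_)
open import Function.Bundles using (_⇔_)

-- Polynomials over F₂ with a canonical (unique) representation.
-- A nonzero polynomial is either 1, or  b + x·q  with q nonzero.

infixr 5 _∷ₚ_
data P⁺ : Set where
  𝟏    : P⁺
  _∷ₚ_ : Bool → P⁺ → P⁺      -- b ∷ₚ q  represents  b + x·q

data Poly : Set where
  𝟎   : Poly
  ⟨_⟩ : P⁺ → Poly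

cons : Bool → Poly → Poly
cons false 𝟎     = 𝟎
cons true  𝟎     = ⟨ 𝟏 ⟩
cons b     ⟨ p ⟩ = ⟨ b ∷ₚ p ⟩

addP : P⁺ → P⁺ → Poly
addP 𝟏        𝟏        = 𝟎
addP 𝟏        (b ∷ₚ q) = ⟨ not b ∷ₚ q ⟩
addP (a ∷ₚ p) 𝟏        = ⟨ not a ∷ₚ p ⟩
addP (a ∷ₚ p) (b ∷ₚ q) = cons (a xor b) (addP p q)

infixl 6 _+_
infixl 7 _*_
infixr 8 _^_

_+_ : Poly → Poly → Poly
𝟎     + q     = q
⟨ p ⟩ + 𝟎     = ⟨ p ⟩
⟨ p ⟩ + ⟨ q ⟩ = addP p q

mulP : P⁺ → Poly → Poly
mulP 𝟏            q = q
mulP (false ∷ₚ p) q = cons false (mulP p q)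
mulP (true  ∷ₚ p) q = q + cons false (mulP p q)

_*_ : Poly → Poly → Poly
𝟎     * q = 𝟎
⟨ p ⟩ * q = mulP p q

one : Poly
one = ⟨ 𝟏 ⟩

_^_ : Poly → ℕ → Poly
p ^ zero  = one
p ^ suc n = p * (p ^ n)

X : Poly
X = ⟨ false ∷ₚ 𝟏 ⟩

X+1 : Poly
X+1 = ⟨ true ∷ₚ 𝟏 ⟩

M₁ : Poly
M₁ = ⟨ true ∷ₚ true ∷ₚ 𝟏 ⟩

M₄ : Poly
M₄ = ⟨ true ∷ₚ true ∷ₚ true ∷ₚ true ∷ₚ 𝟏 ⟩

M₅ : Poly
M₅ = ⟨ true ∷ₚ false ∷ₚ false ∷ₚ true ∷ₚ 𝟏 ⟩

-- S̄(x) = S(x + 1), by Horner: (b + x·q)(x+1) = b + (x+1)·q(x+1)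
const : Bool → Poly
const false = 𝟎
const true  = one

barP : P⁺ → Poly
barP 𝟏        = one
barP (b ∷ₚ q) = const b + X+1 * barP q

bar : Poly → Poly
bar 𝟎     = 𝟎
bar ⟨ p ⟩ = barP p

infix 4 _∣_
_∣_ : Poly → Poly → Set
D ∣ S = ∃ λ Q → D * Q ≡ S

-- gcd(P, Q) = 1 : the only common divisor is 1 (the only unit of F₂[x])
Coprime : Poly → Poly → Set
Coprime P Q = ∀ E → E ∣ P → E ∣ Q → E ≡ one

UnitaryDivisor : Poly → Poly → Set
UnitaryDivisor D S = ∃ λ Q → (D * Q ≡ S) × Coprime D Q

UCoprime : Poly → Poly → Set
UCoprime P Q = ∀ E → UnitaryDivisor E P → UnitaryDivisor E Q → E ≡ one

BiUnitaryDivisor : Poly → Poly → Set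
BiUnitaryDivisor D S = ∃ λ Q → (D * Q ≡ S) × UCoprime D Q

sum : List Poly → Poly
sum = foldr _+_ 𝟎

SigmaBU≡ : Poly → Poly → Set
SigmaBU≡ S T = Σ (List Poly) λ L →
  Unique L × (∀ D → (D ∈ L) ⇔ BiUnitaryDivisor D S) × (sum L ≡ T)

BiUnitaryPerfect : Poly → Set
BiUnitaryPerfect S = (S ≢ 𝟎) × SigmaBU≡ S S

Irreducible : Poly → Set
Irreducible P = (P ≢ 𝟎) × (P ≢ one) × (∀ D → D ∣ P → (D ≡ one) ⊎ (D ≡ P))

Omega≡ : Poly → ℕ → Set
Omega≡ S n = Σ (List Poly) λ L →
  Unique L × (∀ P → (P ∈ L) ⇔ (Irreducible P × P ∣ S)) × (length L ≡ n)

Cs : List Poly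
Cs = X ^ 3 * X+1 ^ 4 * M₁
   ∷ X ^ 3 * X+1 ^ 5 * M₁ ^ 2
   ∷ X ^ 4 * X+1 ^ 4 * M₁ ^ 2
   ∷ X ^ 6 * X+1 ^ 6 * M₁ ^ 2
   ∷ X ^ 4 * X+1 ^ 5 * M₁ ^ 3
   ∷ X ^ 7 * X+1 ^ 8 * M₅
   ∷ X ^ 7 * X+1 ^ 9 * M₅ ^ 2
   ∷ []

{-# OPTIONS --safe #-}
module Submission where

-- If T is a prime divisor of A then 1 + T divides σ**(T^a), so X and X + 1 divide A and A = X^a (X+1)^b P^c.
-- Up to powers of 1 + T, every σ**(T^a) is a product of powers of sums 1 + T + ⋯ + T^(m-1) with m odd. Such a sum is
-- prime to T and 1 + T; for T = X or X + 1 it is also squarefree, hence 1 or P, and for T = P it must be 1.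
-- If P is the sum of length m for T = X, then 1 + P is a product of powers of X and X + 1 only when m = 2^k + 1.
-- Comparing exponents leaves finitely many triples (a, b, c) for each k, and P is irreducible only for k ≤ 2.

open import Defs
open import Algebra.Bundles using (CommutativeRing)
open import Data.Bool using (Bool; true; false; _xor_; _∧_)
import Data.Bool.Properties as Bool
open import Data.Bool.Properties using (xor-comm; xor-assoc; xor-same; xor-identityʳ; ∧-comm)
open import Data.Empty using (⊥; ⊥-elim)
open import Data.List using (List; []; _∷_; _++_; map; applyUpTo; cartesianProductWith)
open import Data.List.Membership.Propositional using (_∈_)
open import Data.List.Membership.Propositional.Properties using (∈-applyUpTo⁺; ∈-applyUpTo⁻; ∈-++⁺ˡ; ∈-++⁺ʳ; ∈-++⁻; ∈-map⁻; ∈-cartesianProductWith⁺; ∈-cartesianProductWith⁻)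
open import Data.List.Membership.Propositional.Properties.WithK using (unique∧set⇒bag)
open import Data.List.Properties using (map-++)
open import Data.List.Relation.Binary.BagAndSetEquality using (∼bag⇒↭)
open import Data.List.Relation.Binary.Permutation.Propositional as ↭ using (_↭_)
open import Data.List.Relation.Unary.All using ([]; _∷_)
open import Data.List.Relation.Unary.All.Properties using (All¬⇒¬Any)
open import Data.List.Relation.Unary.AllPairs using ([]; _∷_)
open import Data.List.Relation.Unary.Any using (here; there)
open import Data.List.Relation.Unary.Unique.Propositional using (Unique)
import Data.List.Relation.Unary.Unique.Propositional.Properties as Unique
open import Data.Maybe using (just; nothing)
open import Data.Nat as ℕ using (ℕ; zero; suc; _≤_; _<_; z≤n; s≤s)
import Data.Nat.Properties as ℕ
import Data.Nat.Tactic.RingSolver as ℕ-Solver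
open import Data.Product using (∃; ∃₂; _×_; _,_; proj₁; proj₂)
open import Data.Sum using (_⊎_; inj₁; inj₂; [_,_]′)
open import Function.Bundles using (_⇔_; mk⇔; Equivalence)
open import Level using (0ℓ)
open import Relation.Binary using (tri<; tri≈; tri>)
open import Relation.Binary.PropositionalEquality using (_≡_; _≢_; refl; sym; trans; cong; cong₂; subst; isEquivalence; module ≡-Reasoning)
open import Relation.Nullary using (¬_; Dec; yes; no)
open import Tactic.RingSolver using (solve-∀)
open import Tactic.RingSolver.Core.AlmostCommutativeRing using (AlmostCommutativeRing; fromCommutativeRing)

-- The ring F₂[x]

-- Why P = 1 + T + ⋯ + T^(2^k) is irreducible only for k ≤ 2: modulo P one has T^(2^k + 1) = 1,
-- hence T^(4^k) = T. If P is irreducible, its residue field is generated by T and so has at most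
-- 4^k elements, that is 2^k = deg P ≤ 2k, which fails from k = 3 on. The code builds no finite
-- fields; a trace polynomial t with P dividing t(t + 1) yields the contradiction instead. Why 1 + P
-- has no prime divisors but X and X + 1: it divides σ**(P^c), hence A, and it is prime to P.
-- Statements about a linear prime are made for a pair T, U with U = 1 + T and are applied to both
-- orders of X and X + 1; `bar` is only evaluated on closed polynomials at the very end. From
-- `Mixed` on the index is shifted: there P has length 2^(k+1) + 1, so the surviving values are k =
-- 0 and k = 1.

coef : Poly → ℕ → Bool
coefP : P⁺ → ℕ → Bool
coef 𝟎     n = false
coef ⟨ p ⟩ n = coefP p n
coefP 𝟏        zero    = true
coefP 𝟏        (suc n) = false
coefP (b ∷ₚ p) zero    = b
coefP (b ∷ₚ p) (suc n) = coefP p n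

coef-cons-zero : ∀ b f → coef (cons b f) 0 ≡ b
coef-cons-zero false 𝟎     = refl
coef-cons-zero true  𝟎     = refl
coef-cons-zero false ⟨ p ⟩ = refl
coef-cons-zero true  ⟨ p ⟩ = refl

coef-cons-suc : ∀ b f n → coef (cons b f) (suc n) ≡ coef f n
coef-cons-suc false 𝟎     n = refl
coef-cons-suc true  𝟎     n = refl
coef-cons-suc false ⟨ p ⟩ n = refl
coef-cons-suc true  ⟨ p ⟩ n = refl

-- `cons` accepts zero and nonzero tails alike, so a single step replaces the case splits that the
-- canonical representation would force on every later proof.
poly-induction : ∀ {ℓ} (M : Poly → Set ℓ) → M 𝟎 → (∀ b f → M f → M (cons b f)) → ∀ f → M f
poly-induction M base step 𝟎     = base
poly-induction M base step ⟨ p ⟩ = go p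
  where
  go : ∀ p → M ⟨ p ⟩
  go 𝟏            = step true 𝟎 base
  go (false ∷ₚ p) = step false ⟨ p ⟩ (go p)
  go (true ∷ₚ p)  = step true ⟨ p ⟩ (go p)

cons-zero : ∀ b f → (∀ n → coef (cons b f) n ≡ false) → (∀ n → coef f n ≡ false)
cons-zero b f h n = trans (sym (coef-cons-suc b f n)) (h (suc n))

coef-zero : ∀ f → (∀ n → coef f n ≡ false) → f ≡ 𝟎
coef-zero = poly-induction _ (λ _ → refl) step
  where
  step : ∀ b f → ((∀ n → coef f n ≡ false) → f ≡ 𝟎) → (∀ n → coef (cons b f) n ≡ false) → cons b f ≡ 𝟎
  step b f ih h = cong₂ cons (trans (sym (coef-cons-zero b f)) (h 0)) (ih (cons-zero b f h))

-- Canonicity of the representation turns coefficientwise equality into propositional equality. The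
-- additive laws thereby reduce to Boolean identities for `xor`.
coef-injective : ∀ f g → (∀ n → coef f n ≡ coef g n) → f ≡ g
coef-injective = poly-induction _ (λ g h → sym (coef-zero g (λ n → sym (h n)))) step
  where
  step : ∀ b f → (∀ g → (∀ n → coef f n ≡ coef g n) → f ≡ g) →
         ∀ g → (∀ n → coef (cons b f) n ≡ coef g n) → cons b f ≡ g
  step b f ih = poly-induction _ (coef-zero _) (λ c g _ h → cong₂ cons
    (trans (sym (coef-cons-zero b f)) (trans (h 0) (coef-cons-zero c g)))
    (ih g (λ n → trans (sym (coef-cons-suc b f n)) (trans (h (suc n)) (coef-cons-suc c g n)))))

coef-+ : ∀ f g n → coef (f + g) n ≡ coef f n xor coef g n
coef-+ 𝟎     g     n = refl
coef-+ ⟨ p ⟩ 𝟎     n = sym (xor-identityʳ _)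
coef-+ ⟨ p ⟩ ⟨ q ⟩ n = go p q n
  where
  go : ∀ p q n → coef (addP p q) n ≡ coefP p n xor coefP q n
  go 𝟏            𝟏            zero    = refl
  go 𝟏            𝟏            (suc n) = refl
  go 𝟏            (b ∷ₚ q)     zero    = refl
  go 𝟏            (b ∷ₚ q)     (suc n) = refl
  go (false ∷ₚ p) 𝟏            zero    = refl
  go (true ∷ₚ p)  𝟏            zero    = refl
  go (a ∷ₚ p)     𝟏            (suc n) = sym (xor-identityʳ _)
  go (a ∷ₚ p)     (b ∷ₚ q)     zero    = coef-cons-zero (a xor b) (addP p q)
  go (a ∷ₚ p)     (b ∷ₚ q)     (suc n) = trans (coef-cons-suc (a xor b) (addP p q) n) (go p q n)

+-comm : ∀ f g → f + g ≡ g + f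
+-comm f g = coef-injective _ _ λ n →
  trans (coef-+ f g n) (trans (xor-comm (coef f n) (coef g n)) (sym (coef-+ g f n)))

+-assoc : ∀ f g h → (f + g) + h ≡ f + (g + h)
+-assoc f g h = coef-injective _ _ λ n → begin
  coef (f + g + h) n                    ≡⟨ coef-+ (f + g) h n ⟩
  coef (f + g) n xor coef h n           ≡⟨ cong (_xor coef h n) (coef-+ f g n) ⟩
  (coef f n xor coef g n) xor coef h n  ≡⟨ xor-assoc (coef f n) (coef g n) (coef h n) ⟩
  coef f n xor (coef g n xor coef h n)  ≡⟨ cong (coef f n xor_) (coef-+ g h n) ⟨
  coef f n xor coef (g + h) n           ≡⟨ coef-+ f (g + h) n ⟨
  coef (f + (g + h)) n                  ∎
  where open ≡-Reasoning

+-identityʳ : ∀ f → f + 𝟎 ≡ f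
+-identityʳ f = +-comm f 𝟎

+-self : ∀ f → f + f ≡ 𝟎
+-self f = coef-zero _ λ n → trans (coef-+ f f n) (xor-same (coef f n))

cons-+ : ∀ a b f g → cons a f + cons b g ≡ cons (a xor b) (f + g)
cons-+ a b f g = coef-injective _ _ λ where
  zero → trans (coef-+ (cons a f) (cons b g) 0) (trans
    (cong₂ _xor_ (coef-cons-zero a f) (coef-cons-zero b g)) (sym (coef-cons-zero (a xor b) (f + g))))
  (suc n) → trans (coef-+ (cons a f) (cons b g) (suc n)) (trans
    (cong₂ _xor_ (coef-cons-suc a f n) (coef-cons-suc b g n))
    (trans (sym (coef-+ f g n)) (sym (coef-cons-suc (a xor b) (f + g) n))))

infixr 7 _·_
_·_ : Bool → Poly → Poly
false · f = 𝟎
true  · f = f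

cons-* : ∀ b f g → cons b f * g ≡ b · g + cons false (f * g)
cons-* false 𝟎     g = refl
cons-* true  𝟎     g = sym (+-identityʳ g)
cons-* false ⟨ p ⟩ g = refl
cons-* true  ⟨ p ⟩ g = refl

·-+ : ∀ b f g → b · (f + g) ≡ b · f + b · g
·-+ false f g = refl
·-+ true  f g = refl

·-* : ∀ b f g → b · (f * g) ≡ (b · f) * g
·-* false f g = refl
·-* true  f g = refl

+-interchange : ∀ a b c d → (a + b) + (c + d) ≡ (a + c) + (b + d)
+-interchange a b c d = begin
  (a + b) + (c + d) ≡⟨ +-assoc a b (c + d) ⟩
  a + (b + (c + d)) ≡⟨ cong (a +_) (+-assoc b c d) ⟨
  a + ((b + c) + d) ≡⟨ cong (λ z → a + (z + d)) (+-comm b c) ⟩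
  a + ((c + b) + d) ≡⟨ cong (a +_) (+-assoc c b d) ⟩
  a + (c + (b + d)) ≡⟨ +-assoc a c (b + d) ⟨
  (a + c) + (b + d) ∎
  where open ≡-Reasoning

*-distribˡ : ∀ f g h → f * (g + h) ≡ f * g + f * h
*-distribˡ f g h = poly-induction (λ f → f * (g + h) ≡ f * g + f * h) refl step f
  where
  open ≡-Reasoning
  step : ∀ b f → f * (g + h) ≡ f * g + f * h → cons b f * (g + h) ≡ cons b f * g + cons b f * h
  step b f ih = begin
    cons b f * (g + h)                                              ≡⟨ cons-* b f (g + h) ⟩
    b · (g + h) + cons false (f * (g + h))                          ≡⟨ cong₂ _+_ (·-+ b g h) (cong (cons false) ih) ⟩
    (b · g + b · h) + cons false (f * g + f * h)                    ≡⟨ cong ((b · g + b · h) +_) (cons-+ false false (f * g) (f * h)) ⟨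
    (b · g + b · h) + (cons false (f * g) + cons false (f * h))     ≡⟨ +-interchange (b · g) (b · h) _ _ ⟩
    (b · g + cons false (f * g)) + (b · h + cons false (f * h))     ≡⟨ cong₂ _+_ (cons-* b f g) (cons-* b f h) ⟨
    cons b f * g + cons b f * h                                     ∎

*-zeroʳ : ∀ f → f * 𝟎 ≡ 𝟎
*-zeroʳ = poly-induction _ refl λ where
  false f ih → trans (cons-* false f 𝟎) (cong (cons false) ih)
  true  f ih → trans (cons-* true f 𝟎) (cong (cons false) ih)

·-cons : ∀ a b f → a · cons b f ≡ cons (a ∧ b) (a · f)
·-cons false b f = refl
·-cons true  b f = refl

-- Mirror image of `cons-*`. Multiplication recurses on its left argument, and this rule for the
-- right argument is exactly the induction step of `*-comm`.
*-cons : ∀ f b g → f * cons b g ≡ b · f + cons false (f * g)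
*-cons f b g = poly-induction (λ f → f * cons b g ≡ b · f + cons false (f * g)) (base b) step f
  where
  open ≡-Reasoning
  base : ∀ b → 𝟎 ≡ b · 𝟎 + 𝟎
  base false = refl
  base true  = refl
  shift : ∀ a b f g h → a · cons b g + cons false (b · f + h) ≡ cons (a ∧ b) (a · g + (b · f + h))
  shift a b f g h = begin
    a · cons b g + cons false (b · f + h)            ≡⟨ cong (_+ cons false (b · f + h)) (·-cons a b g) ⟩
    cons (a ∧ b) (a · g) + cons false (b · f + h)    ≡⟨ cons-+ (a ∧ b) false _ _ ⟩
    cons ((a ∧ b) xor false) (a · g + (b · f + h))   ≡⟨ cong (λ c → cons c (a · g + (b · f + h))) (xor-identityʳ (a ∧ b)) ⟩
    cons (a ∧ b) (a · g + (b · f + h))               ∎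
  step : ∀ a f → f * cons b g ≡ b · f + cons false (f * g) →
         cons a f * cons b g ≡ b · cons a f + cons false (cons a f * g)
  step a f ih = begin
    cons a f * cons b g                                             ≡⟨ cons-* a f (cons b g) ⟩
    a · cons b g + cons false (f * cons b g)                        ≡⟨ cong (λ z → a · cons b g + cons false z) ih ⟩
    a · cons b g + cons false (b · f + cons false (f * g))          ≡⟨ shift a b f g _ ⟩
    cons (a ∧ b) (a · g + (b · f + cons false (f * g)))             ≡⟨ cong₂ cons (∧-comm a b) (rotate (a · g) (b · f) _) ⟩
    cons (b ∧ a) (b · f + (a · g + cons false (f * g)))             ≡⟨ shift b a g f _ ⟨
    b · cons a f + cons false (a · g + cons false (f * g))          ≡⟨ cong (λ z → b · cons a f + cons false z) (cons-* a f g) ⟨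
    b · cons a f + cons false (cons a f * g)                        ∎
    where
    rotate : ∀ x y z → x + (y + z) ≡ y + (x + z)
    rotate x y z = trans (sym (+-assoc x y z)) (trans (cong (_+ z) (+-comm x y)) (+-assoc y x z))

*-comm : ∀ f g → f * g ≡ g * f
*-comm f g = poly-induction (λ f → f * g ≡ g * f) (sym (*-zeroʳ g))
  (λ b f ih → trans (cons-* b f g) (trans (cong (λ z → b · g + cons false z) ih) (sym (*-cons g b f)))) f

*-distribʳ : ∀ h f g → (f + g) * h ≡ f * h + g * h
*-distribʳ h f g = trans (*-comm (f + g) h) (trans (*-distribˡ h f g) (cong₂ _+_ (*-comm h f) (*-comm h g)))

*-assoc : ∀ f g h → (f * g) * h ≡ f * (g * h)
*-assoc f g h = poly-induction (λ f → (f * g) * h ≡ f * (g * h)) refl step f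
  where
  open ≡-Reasoning
  step : ∀ b f → (f * g) * h ≡ f * (g * h) → (cons b f * g) * h ≡ cons b f * (g * h)
  step b f ih = begin
    (cons b f * g) * h                          ≡⟨ cong (_* h) (cons-* b f g) ⟩
    (b · g + cons false (f * g)) * h            ≡⟨ *-distribʳ h (b · g) _ ⟩
    (b · g) * h + cons false (f * g) * h        ≡⟨ cong₂ _+_ (sym (·-* b g h)) (cons-* false (f * g) h) ⟩
    b · (g * h) + cons false ((f * g) * h)      ≡⟨ cong (λ z → b · (g * h) + cons false z) ih ⟩
    b · (g * h) + cons false (f * (g * h))      ≡⟨ cons-* b f (g * h) ⟨
    cons b f * (g * h)                          ∎

*-identityʳ : ∀ f → f * one ≡ f
*-identityʳ f = *-comm f one

F₂[x] : CommutativeRing 0ℓ 0ℓ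
F₂[x] = record
  { Carrier = Poly ; _≈_ = _≡_ ; _+_ = _+_ ; _*_ = _*_ ; -_ = λ f → f ; 0# = 𝟎 ; 1# = one
  ; isCommutativeRing = record
    { isRing = record
      { +-isAbelianGroup = record
        { isGroup = record
          { isMonoid = record
            { isSemigroup = record
              { isMagma = record { isEquivalence = isEquivalence ; ∙-cong = cong₂ _+_ }
              ; assoc = +-assoc }
            ; identity = (λ _ → refl) , +-identityʳ }
          ; inverse = +-self , +-self
          ; ⁻¹-cong = λ e → e }
        ; comm = +-comm }
      ; *-cong = cong₂ _*_
      ; *-assoc = *-assoc
      ; *-identity = (λ _ → refl) , *-identityʳ
      ; distrib = *-distribˡ , *-distribʳ }
    ; *-comm = *-comm } }

-- The zero test lets the solver recognise the coefficient one + one as zero, so that it also proves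
-- identities special to characteristic 2.
ring : AlmostCommutativeRing 0ℓ 0ℓ
ring = fromCommutativeRing F₂[x] λ { 𝟎 → just refl ; ⟨ _ ⟩ → nothing }

-- Degree and division

deg : P⁺ → ℕ
deg 𝟏        = 0
deg (b ∷ₚ p) = suc (deg p)

-- The degree plus one, so that 𝟎 gets a size of its own.
size : Poly → ℕ
size 𝟎     = 0
size ⟨ p ⟩ = suc (deg p)

size-cons : ∀ b f → size (cons b f) ≤ suc (size f)
size-cons false 𝟎     = z≤n
size-cons true  𝟎     = ℕ.≤-refl
size-cons false ⟨ p ⟩ = ℕ.≤-refl
size-cons true  ⟨ p ⟩ = ℕ.≤-refl

cons-⟨⟩ : ∀ b p → cons b ⟨ p ⟩ ≡ ⟨ b ∷ₚ p ⟩
cons-⟨⟩ false p = refl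
cons-⟨⟩ true  p = refl

size-addP-≤ : ∀ p q n → deg p ≤ n → deg q ≤ n → size (addP p q) ≤ suc n
size-addP-≤ 𝟏        𝟏        n       _       _       = z≤n
size-addP-≤ 𝟏        (b ∷ₚ q) n       _       h       = s≤s h
size-addP-≤ (a ∷ₚ p) 𝟏        n       h       _       = s≤s h
size-addP-≤ (a ∷ₚ p) (b ∷ₚ q) (suc n) (s≤s h) (s≤s k) =
  ℕ.≤-trans (size-cons _ (addP p q)) (s≤s (size-addP-≤ p q n h k))

size-+-≤ : ∀ f g {n} → size f ≤ n → size g ≤ n → size (f + g) ≤ n
size-+-≤ 𝟎     g     h       k       = k
size-+-≤ ⟨ p ⟩ 𝟎     h       k       = h
size-+-≤ ⟨ p ⟩ ⟨ q ⟩ (s≤s h) (s≤s k) = size-addP-≤ p q _ h k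

addP-< : ∀ p q → deg p < deg q → ∃ λ r → addP p q ≡ ⟨ r ⟩ × deg r ≡ deg q
addP-< 𝟏        (b ∷ₚ q) _       = _ , refl , refl
addP-< (a ∷ₚ p) (b ∷ₚ q) (s≤s h) with addP p q | addP-< p q h
... | _ | r , refl , e = _ , cons-⟨⟩ _ r , cong suc e

-- Both leading coefficients are 1 and cancel: the reduction step of long division.
size-addP-≡ : ∀ p q → deg p ≡ deg q → size (addP p q) ≤ deg p
size-addP-≡ 𝟏        𝟏        _ = z≤n
size-addP-≡ (a ∷ₚ p) (b ∷ₚ q) e =
  ℕ.≤-trans (size-cons _ (addP p q)) (s≤s (size-addP-≡ p q (ℕ.suc-injective e)))

deg-mulP : ∀ p q → ∃ λ r → mulP p ⟨ q ⟩ ≡ ⟨ r ⟩ × deg r ≡ deg p ℕ.+ deg q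
deg-mulP 𝟏            q = q , refl , refl
deg-mulP (false ∷ₚ p) q with mulP p ⟨ q ⟩ | deg-mulP p q
... | _ | r , refl , e = _ , refl , cong suc e
deg-mulP (true ∷ₚ p) q with mulP p ⟨ q ⟩ | deg-mulP p q
... | _ | r , refl , e with addP q (false ∷ₚ r) | addP-< q (false ∷ₚ r) (s≤s (subst (deg q ≤_) (sym e) (ℕ.m≤n+m (deg q) (deg p))))
...   | _ | s , refl , e′ = s , refl , trans e′ (cong suc e)

*-nonzero : ∀ {f g} → f ≢ 𝟎 → g ≢ 𝟎 → f * g ≢ 𝟎
*-nonzero {𝟎}     {g}     f≢0 _ _ = f≢0 refl
*-nonzero {⟨ p ⟩} {𝟎}     _ g≢0 _ = g≢0 refl
*-nonzero {⟨ p ⟩} {⟨ q ⟩} _ _ e with mulP p ⟨ q ⟩ | deg-mulP p q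
... | _ | r , refl , _ with () ← e

nonzero-factorˡ : ∀ {f g h} → f * g ≡ h → h ≢ 𝟎 → f ≢ 𝟎
nonzero-factorˡ e h≢0 refl = h≢0 (sym e)

nonzero-factorʳ : ∀ {f g h} → f * g ≡ h → h ≢ 𝟎 → g ≢ 𝟎
nonzero-factorʳ {f} e h≢0 refl = h≢0 (trans (sym e) (*-zeroʳ f))

+≡𝟎⇒≡ : ∀ f g → f + g ≡ 𝟎 → f ≡ g
+≡𝟎⇒≡ f g e = trans (identity f g) (cong (_+ g) e)
  where
  identity : ∀ f g → f ≡ (f + g) + g
  identity = solve-∀ ring

≡⇒+≡𝟎 : ∀ {f g} → f ≡ g → f + g ≡ 𝟎
≡⇒+≡𝟎 {f} refl = +-self f

infix 4 _≟_
_≟_ : (f g : Poly) → Dec (f ≡ g)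
𝟎     ≟ 𝟎     = yes refl
𝟎     ≟ ⟨ q ⟩ = no λ ()
⟨ p ⟩ ≟ 𝟎     = no λ ()
⟨ p ⟩ ≟ ⟨ q ⟩ with go p q
  where
  go : (p q : P⁺) → Dec (p ≡ q)
  go 𝟏        𝟏        = yes refl
  go 𝟏        (b ∷ₚ q) = no λ ()
  go (a ∷ₚ p) 𝟏        = no λ ()
  go (a ∷ₚ p) (b ∷ₚ q) with a Bool.≟ b | go p q
  ... | yes refl | yes refl = yes refl
  ... | no a≢b   | _        = no λ { refl → a≢b refl }
  ... | _        | no p≢q   = no λ { refl → p≢q refl }
... | yes refl = yes refl
... | no p≢q   = no λ { refl → p≢q refl }

*-cancelˡ : ∀ {f g h} → f ≢ 𝟎 → f * g ≡ f * h → g ≡ h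
*-cancelˡ {f} {g} {h} f≢0 e with g + h ≟ 𝟎
... | yes z = +≡𝟎⇒≡ g h z
... | no nz = ⊥-elim (*-nonzero f≢0 nz (trans (*-distribˡ f g h) (≡⇒+≡𝟎 e)))

size-* : ∀ {f g} → f ≢ 𝟎 → g ≢ 𝟎 → suc (size (f * g)) ≡ size f ℕ.+ size g
size-* {𝟎}             f≢0 _ = ⊥-elim (f≢0 refl)
size-* {⟨ p ⟩} {𝟎}     _ g≢0 = ⊥-elim (g≢0 refl)
size-* {⟨ p ⟩} {⟨ q ⟩} _ _ with mulP p ⟨ q ⟩ | deg-mulP p q
... | _ | r , refl , e = trans (cong (λ z → suc (suc z)) e) (sym (cong suc (ℕ.+-suc (deg p) (deg q))))

size-≡0 : ∀ {f} → size f ≤ 0 → f ≡ 𝟎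
size-≡0 {𝟎} _ = refl

size-≡1 : ∀ {f} → f ≢ 𝟎 → size f ≤ 1 → f ≡ one
size-≡1 {𝟎}          f≢0 _ = ⊥-elim (f≢0 refl)
size-≡1 {⟨ 𝟏 ⟩}      _   _ = refl
size-≡1 {⟨ b ∷ₚ p ⟩} _   (s≤s ())

size-≥1 : ∀ {f} → f ≢ 𝟎 → 1 ≤ size f
size-≥1 {𝟎}     f≢0 = ⊥-elim (f≢0 refl)
size-≥1 {⟨ p ⟩} _   = s≤s z≤n

size-≥2 : ∀ {f} → f ≢ 𝟎 → f ≢ one → 2 ≤ size f
size-≥2 {𝟎}          f≢0 _   = ⊥-elim (f≢0 refl)
size-≥2 {⟨ 𝟏 ⟩}      _   f≢1 = ⊥-elim (f≢1 refl)
size-≥2 {⟨ b ∷ₚ p ⟩} _   _   = s≤s (s≤s z≤n)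

size-factorˡ : ∀ {f g} → f ≢ 𝟎 → g ≢ 𝟎 → size f ≤ size (f * g)
size-factorˡ {f} {g} f≢0 g≢0 = ℕ.≤-pred (subst (suc (size f) ≤_) (sym (size-* f≢0 g≢0))
  (subst (_≤ size f ℕ.+ size g) (ℕ.+-comm (size f) 1) (ℕ.+-monoʳ-≤ (size f) (size-≥1 g≢0))))

size-factorˡ-< : ∀ {f g} → f ≢ 𝟎 → g ≢ 𝟎 → g ≢ one → size f < size (f * g)
size-factorˡ-< {f} {g} f≢0 g≢0 g≢1 = ℕ.≤-pred (subst (suc (suc (size f)) ≤_) (sym (size-* f≢0 g≢0))
  (subst (_≤ size f ℕ.+ size g) (ℕ.+-comm (size f) 2) (ℕ.+-monoʳ-≤ (size f) (size-≥2 g≢0 g≢1))))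

-- Long division in Horner form. If f leaves remainder r, then b + x·f leaves b + x·r, whose size
-- has grown by at most one, so subtracting p at most once restores the bound.
divMod : ∀ p f → ∃₂ λ q r → f ≡ ⟨ p ⟩ * q + r × size r ≤ deg p
divMod p = poly-induction _ (𝟎 , 𝟎 , sym (trans (+-identityʳ _) (*-zeroʳ ⟨ p ⟩)) , z≤n) step
  where
  open ≡-Reasoning
  adjust : ∀ P q r → P * q + r ≡ P * (q + one) + (r + P)
  adjust = solve-∀ ring
  step : ∀ b f → (∃₂ λ q r → f ≡ ⟨ p ⟩ * q + r × size r ≤ deg p) →
         ∃₂ λ q r → cons b f ≡ ⟨ p ⟩ * q + r × size r ≤ deg p
  step b f (q , r , e , s) = reduce (cons b r) shifted (ℕ.≤-trans (size-cons b r) (s≤s s))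
    where
    shifted : cons b f ≡ ⟨ p ⟩ * cons false q + cons b r
    shifted = begin
      cons b f                                   ≡⟨ cong (cons b) e ⟩
      cons b (⟨ p ⟩ * q + r)                     ≡⟨ cons-+ false b (⟨ p ⟩ * q) r ⟨
      cons false (⟨ p ⟩ * q) + cons b r          ≡⟨ cong (_+ cons b r) (*-cons ⟨ p ⟩ false q) ⟨
      ⟨ p ⟩ * cons false q + cons b r            ∎
    reduce : ∀ g → cons b f ≡ ⟨ p ⟩ * cons false q + g → size g ≤ suc (deg p) →
             ∃₂ λ q r → cons b f ≡ ⟨ p ⟩ * q + r × size r ≤ deg p
    reduce 𝟎     e _ = _ , 𝟎 , e , z≤n
    reduce ⟨ r ⟩ e (s≤s s) with ℕ.m≤n⇒m<n∨m≡n s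
    ... | inj₁ lt = _ , ⟨ r ⟩ , e , lt
    ... | inj₂ eq = _ , _ , trans e (adjust ⟨ p ⟩ (cons false q) ⟨ r ⟩) , subst (size (addP r p) ≤_) eq (size-addP-≡ r p eq)

-- Divisibility and irreducible polynomials

-- A record copy of _∣_ : unlike the unfolding _∣_, it lets the divisor be inferred.
infix 4 _≼_
record _≼_ (f g : Poly) : Set where
  constructor divides
  field
    quotient : Poly
    equality : f * quotient ≡ g

≼⇒∣ : ∀ {f g} → f ≼ g → f ∣ g
≼⇒∣ (divides q e) = q , e

∣⇒≼ : ∀ {f g} → f ∣ g → f ≼ g
∣⇒≼ (q , e) = divides q e

≼-refl : ∀ {f} → f ≼ f
≼-refl {f} = divides one (*-identityʳ f)

≼-trans : ∀ {f g h} → f ≼ g → g ≼ h → f ≼ h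
≼-trans {f} (divides q refl) (divides r refl) = divides (q * r) (sym (*-assoc f q r))

≼-*ʳ : ∀ {f g} h → f ≼ g → f ≼ g * h
≼-*ʳ h f∣g = ≼-trans f∣g (divides h refl)

≼-*ˡ : ∀ {f g} h → f ≼ g → f ≼ h * g
≼-*ˡ {g = g} h f∣g = ≼-trans f∣g (divides h (*-comm g h))

≼-+ : ∀ {f g h} → f ≼ g → f ≼ h → f ≼ g + h
≼-+ {f} (divides q refl) (divides r refl) = divides (q + r) (*-distribˡ f q r)

≼-+-cancelˡ : ∀ {f} g {h} → f ≼ g → f ≼ g + h → f ≼ h
≼-+-cancelˡ g {h} f∣g f∣g+h = subst (_ ≼_) (identity g h) (≼-+ f∣g f∣g+h)
  where
  identity : ∀ g h → g + (g + h) ≡ h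
  identity = solve-∀ ring

≼-𝟎 : ∀ {f} → f ≼ 𝟎
≼-𝟎 {f} = divides 𝟎 (*-zeroʳ f)

*≡one⇒≡one : ∀ {f g} → f * g ≡ one → f ≡ one
*≡one⇒≡one {f} {g} e = size-≡1 f≢0 (subst (λ z → size f ≤ size z) e (size-factorˡ f≢0 (nonzero-factorʳ {f} e λ ())))
  where
  f≢0 : f ≢ 𝟎
  f≢0 = nonzero-factorˡ e λ ()

≼one⇒≡one : ∀ {f} → f ≼ one → f ≡ one
≼one⇒≡one (divides q e) = *≡one⇒≡one e

^-+ : ∀ f m n → f ^ (m ℕ.+ n) ≡ f ^ m * f ^ n
^-+ f zero    n = refl
^-+ f (suc m) n = trans (cong (f *_) (^-+ f m n)) (sym (*-assoc f (f ^ m) (f ^ n)))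

^-* : ∀ f m n → f ^ (m ℕ.* n) ≡ (f ^ m) ^ n
^-* f m zero    = cong (f ^_) (ℕ.*-zeroʳ m)
^-* f m (suc n) = trans (cong (f ^_) (ℕ.*-suc m n)) (trans (^-+ f m (m ℕ.* n)) (cong (f ^ m *_) (^-* f m n)))

one^ : ∀ n → one ^ n ≡ one
one^ zero    = refl
one^ (suc n) = one^ n

^-distrib-* : ∀ f g n → (f * g) ^ n ≡ f ^ n * g ^ n
^-distrib-* f g zero    = refl
^-distrib-* f g (suc n) = trans (cong (f * g *_) (^-distrib-* f g n)) (regroup f g (f ^ n) (g ^ n))
  where
  regroup : ∀ f g a b → f * g * (a * b) ≡ f * a * (g * b)
  regroup = solve-∀ ring

^-nonzero : ∀ {f} n → f ≢ 𝟎 → f ^ n ≢ 𝟎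
^-nonzero zero    f≢0 ()
^-nonzero (suc n) f≢0 = *-nonzero f≢0 (^-nonzero n f≢0)

_≼?_ : ∀ f g → Dec (f ≼ g)
𝟎     ≼? 𝟎     = yes ≼-𝟎
𝟎     ≼? ⟨ q ⟩ = no λ { (divides _ ()) }
⟨ p ⟩ ≼? g with divMod p g
... | q , 𝟎     , e , _ = yes (divides q (trans (sym (+-identityʳ _)) (sym e)))
... | q , ⟨ r ⟩ , e , s = no λ { (divides q′ e′) → absurd q′ (difference e e′) }
  where
  identity : ∀ P q q′ r → P * (q + q′) ≡ (P * q + r) + P * q′ + r
  identity = solve-∀ ring
  difference : ∀ {q′} → g ≡ ⟨ p ⟩ * q + ⟨ r ⟩ → ⟨ p ⟩ * q′ ≡ g → ⟨ p ⟩ * (q + q′) ≡ ⟨ r ⟩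
  difference {q′} e e′ = trans (identity ⟨ p ⟩ q q′ ⟨ r ⟩)
    (cong (_+ ⟨ r ⟩) (trans (cong₂ _+_ (sym e) e′) (+-self g)))
  absurd : ∀ q′ → ⟨ p ⟩ * (q + q′) ≡ ⟨ r ⟩ → ⊥
  absurd q′ d = ℕ.<-irrefl refl (ℕ.≤-trans
    (subst (λ z → size ⟨ p ⟩ ≤ size z) d (size-factorˡ {⟨ p ⟩} (λ ()) (nonzero-factorʳ {⟨ p ⟩} d λ ()))) s)

irreducible-nonzero : ∀ {P} → Irreducible P → P ≢ 𝟎
irreducible-nonzero (nz , _) = nz

irreducible∤one : ∀ {P} → Irreducible P → ¬ P ≼ one
irreducible∤one (_ , nu , _) d = nu (≼one⇒≡one d)

irreducible-∣ : ∀ {P Q} → Irreducible P → Irreducible Q → P ≼ Q → P ≡ Q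
irreducible-∣ (_ , P≢1 , _) (_ , _ , dvd) P∣Q with dvd _ (≼⇒∣ P∣Q)
... | inj₁ P≡1 = ⊥-elim (P≢1 P≡1)
... | inj₂ P≡Q = P≡Q

-- P ∣ r * g implies P ∣ (P mod r) * g, so r can be replaced by smaller remainders until it is 1.
euclid-reduced : ∀ {P} → Irreducible P → ∀ n r g → size r ≤ n → r ≢ 𝟎 → size r < size P → P ≼ r * g → P ≼ g
euclid-reduced irr zero r g s r≢0 _ _ = ⊥-elim (r≢0 (size-≡0 s))
euclid-reduced irr (suc n) 𝟎 g _ r≢0 _ _ = ⊥-elim (r≢0 refl)
euclid-reduced {P} irr@(_ , _ , dvd) (suc n) ⟨ r ⟩ g (s≤s s) _ lt d with divMod r P
... | q , 𝟎 , e , _ with dvd ⟨ r ⟩ (q , trans (sym (+-identityʳ _)) (sym e))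
...   | inj₁ refl = d
...   | inj₂ refl = ⊥-elim (ℕ.<-irrefl refl lt)
euclid-reduced {P} irr (suc n) ⟨ r ⟩ g (s≤s s) _ lt d | q , r′@(⟨ _ ⟩) , e , s′ =
  euclid-reduced irr n r′ g (ℕ.≤-trans s′ s) (λ ()) (ℕ.≤-<-trans s′ (ℕ.<-trans (ℕ.n<1+n _) lt)) P∣r′g
  where
  identity : ∀ r q r′ g → (r * q + r′) * g + q * (r * g) ≡ r′ * g
  identity = solve-∀ ring
  P∣r′g : P ≼ r′ * g
  P∣r′g = subst (P ≼_) (trans (cong (λ z → z * g + q * (⟨ r ⟩ * g)) e) (identity ⟨ r ⟩ q r′ g))
    (≼-+ (≼-*ʳ g ≼-refl) (≼-*ˡ q d))

euclid : ∀ {P} f g → Irreducible P → P ≼ f * g → P ≼ f ⊎ P ≼ g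
euclid {𝟎} f g (P≢0 , _) _ = ⊥-elim (P≢0 refl)
euclid {⟨ p ⟩} f g irr d with divMod p f
... | q , 𝟎 , e , _ = inj₁ (divides q (trans (sym (+-identityʳ _)) (sym e)))
... | q , ⟨ r ⟩ , e , s = inj₂ (euclid-reduced irr _ ⟨ r ⟩ g ℕ.≤-refl (λ ()) (s≤s s)
  (subst (⟨ p ⟩ ≼_) (trans (cong (λ z → z * g + ⟨ p ⟩ * (q * g)) e) (identity ⟨ p ⟩ q ⟨ r ⟩ g))
    (≼-+ d (divides (q * g) refl))))
  where
  identity : ∀ P q r g → (P * q + r) * g + P * (q * g) ≡ r * g
  identity = solve-∀ ring

euclid-^ : ∀ {P} f n → Irreducible P → P ≼ f ^ n → P ≼ f
euclid-^ f zero    irr d = ⊥-elim (irreducible∤one irr d)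
euclid-^ f (suc n) irr d = [ (λ e → e) , euclid-^ f n irr ]′ (euclid f (f ^ n) irr d)

-- By induction on the size all proper divisors of f are `one`; were f itself not `one`, it would be
-- an irreducible divisor of itself.
no-irreducible-divisor⇒one : ∀ f → f ≢ 𝟎 → (∀ P → Irreducible P → ¬ P ≼ f) → f ≡ one
no-irreducible-divisor⇒one f = go (size f) f ℕ.≤-refl
  where
  go : ∀ n f → size f ≤ n → f ≢ 𝟎 → (∀ P → Irreducible P → ¬ P ≼ f) → f ≡ one
  go zero    f s f≢0 _ = ⊥-elim (f≢0 (size-≡0 s))
  go (suc n) f s f≢0 h with f ≟ one
  ... | yes f≡1 = f≡1
  ... | no f≢1  = ⊥-elim (h f (f≢0 , f≢1 , trivial) ≼-refl)
    where
    trivial : ∀ D → D ∣ f → D ≡ one ⊎ D ≡ f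
    trivial D (Q , e) with Q ≟ one
    ... | yes refl = inj₂ (trans (sym (*-identityʳ D)) e)
    ... | no Q≢1   = inj₁ (go n D (ℕ.≤-pred (ℕ.≤-trans lt s)) D≢0 (λ P irr P∣D → h P irr (≼-trans P∣D (divides Q e))))
      where
      D≢0 : D ≢ 𝟎
      D≢0 = nonzero-factorˡ e f≢0
      lt : size D < size f
      lt = subst (λ z → size D < size z) e (size-factorˡ-< D≢0 (nonzero-factorʳ {D} e f≢0) Q≢1)

-- P-adic valuations

module Valuation {P : Poly} (irr : Irreducible P) where

  P≢𝟎 : P ≢ 𝟎
  P≢𝟎 = irreducible-nonzero irr

  ∤⇒≢𝟎 : ∀ {f} → ¬ P ≼ f → f ≢ 𝟎
  ∤⇒≢𝟎 P∤f refl = P∤f ≼-𝟎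

  ∤-* : ∀ {f g} → ¬ P ≼ f → ¬ P ≼ g → ¬ P ≼ f * g
  ∤-* {f} {g} P∤f P∤g d = [ P∤f , P∤g ]′ (euclid f g irr d)

  split : ∀ f → f ≢ 𝟎 → ∃₂ λ e f′ → f ≡ P ^ e * f′ × ¬ P ≼ f′
  split f = go (size f) f ℕ.≤-refl
    where
    go : ∀ n f → size f ≤ n → f ≢ 𝟎 → ∃₂ λ e f′ → f ≡ P ^ e * f′ × ¬ P ≼ f′
    go zero    f s f≢0 = ⊥-elim (f≢0 (size-≡0 s))
    go (suc n) f s f≢0 with P ≼? f
    ... | no P∤f = 0 , f , refl , P∤f
    ... | yes (divides q e) with go n q (ℕ.≤-pred (ℕ.≤-trans lt s)) q≢0
      where
      q≢0 : q ≢ 𝟎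
      q≢0 = nonzero-factorʳ {P} e f≢0
      lt : size q < size f
      lt = subst (λ z → size q < size z) (trans (*-comm q P) e) (size-factorˡ-< q≢0 P≢𝟎 (proj₁ (proj₂ irr)))
    ...   | k , f′ , e′ , P∤f′ = suc k , f′ , trans (sym e) (trans (cong (P *_) e′) (sym (*-assoc P (P ^ k) f′))) , P∤f′

  split-unique : ∀ i j {f g} → ¬ P ≼ f → ¬ P ≼ g → P ^ i * f ≡ P ^ j * g → i ≡ j × f ≡ g
  split-unique zero    zero    _   _   e = refl , e
  split-unique zero    (suc j) {g = g} P∤f _ e = ⊥-elim (P∤f (subst (P ≼_) (sym e) (≼-*ʳ g (divides (P ^ j) refl))))
  split-unique (suc i) zero    {f} _ P∤g e = ⊥-elim (P∤g (subst (P ≼_) e (≼-*ʳ f (divides (P ^ i) refl))))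
  split-unique (suc i) (suc j) {f} {g} P∤f P∤g e
    with split-unique i j P∤f P∤g (*-cancelˡ P≢𝟎 (trans (sym (*-assoc P (P ^ i) f)) (trans e (*-assoc P (P ^ j) g))))
  ... | refl , f≡g = refl , f≡g

  -- Unique factorisation, localised at one prime: a factorisation of `P ^ a * B` with P prime to B
  -- is a splitting of a together with a factorisation of B. Iterating it handles several primes one
  -- at a time.
  record SplitFactors (a : ℕ) (B D Q : Poly) : Set where
    constructor splitFactors
    field
      {i j}   : ℕ
      {D′ Q′} : Poly
      D≡      : D ≡ P ^ i * D′
      Q≡      : Q ≡ P ^ j * Q′
      P∤D′    : ¬ P ≼ D′
      P∤Q′    : ¬ P ≼ Q′
      i+j≡a   : i ℕ.+ j ≡ a
      D′Q′≡B  : D′ * Q′ ≡ B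

  merge : ∀ i j D Q → P ^ i * D * (P ^ j * Q) ≡ P ^ (i ℕ.+ j) * (D * Q)
  merge i j D Q = trans (regroup (P ^ i) D (P ^ j) Q) (cong (_* (D * Q)) (sym (^-+ P i j)))
    where
    regroup : ∀ a b c d → a * b * (c * d) ≡ a * c * (b * d)
    regroup = solve-∀ ring

  split-factors : ∀ a B D Q → ¬ P ≼ B → D * Q ≡ P ^ a * B → SplitFactors a B D Q
  split-factors a B D Q P∤B e with split D (nonzero-factorˡ e nz) | split Q (nonzero-factorʳ {D} e nz)
    where
    nz : P ^ a * B ≢ 𝟎
    nz = *-nonzero (^-nonzero a P≢𝟎) (∤⇒≢𝟎 P∤B)
  ... | i , D′ , refl , P∤D′ | j , Q′ , refl , P∤Q′
    with split-unique (i ℕ.+ j) a (∤-* P∤D′ P∤Q′) P∤B (trans (sym (merge i j D′ Q′)) e)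
  ... | i+j≡a , D′Q′≡B = splitFactors {i = i} {j} refl refl P∤D′ P∤Q′ i+j≡a D′Q′≡B

sum-++ : ∀ xs ys → sum (xs ++ ys) ≡ sum xs + sum ys
sum-++ []       ys = refl
sum-++ (x ∷ xs) ys = trans (cong (x +_) (sum-++ xs ys)) (sym (+-assoc x (sum xs) (sum ys)))

sum-map-* : ∀ f xs → sum (map (f *_) xs) ≡ f * sum xs
sum-map-* f []       = sym (*-zeroʳ f)
sum-map-* f (x ∷ xs) = trans (cong (f * x +_) (sum-map-* f xs)) (sym (*-distribˡ f x (sum xs)))

-- Bi-unitary divisors of P ^ a * B for P prime to B

module _ {P : Poly} (irr : Irreducible P) where
  open Valuation irr

  P∣P^suc : ∀ i f → P ≼ P ^ suc i * f
  P∣P^suc i f = ≼-*ʳ f (divides (P ^ i) refl)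

  coprime-^ : ∀ i {D} → ¬ P ≼ D → Coprime (P ^ i) D
  coprime-^ i {D} P∤D E (Q , e) (R , e′)
    with split-factors i one E Q (irreducible∤one irr) (trans e (sym (*-identityʳ (P ^ i))))
  ... | splitFactors {zero} refl _ _ _ _ u = *≡one⇒≡one u
  ... | splitFactors {suc k} {D′ = D′} refl _ _ _ _ _ = ⊥-elim (P∤D (≼-trans (P∣P^suc k D′) (divides R e′)))

  coprime-*^ : ∀ i {E F} → ¬ P ≼ E → ¬ P ≼ F → Coprime E F → Coprime E (P ^ i * F)
  coprime-*^ i {E} {F} P∤E P∤F coprime G (Q , e) (H , e′) with split-factors i F G H P∤F e′
  ... | splitFactors {zero} {Q′ = Q′} refl _ _ _ _ u = coprime G (Q , e) (Q′ , u)
  ... | splitFactors {suc k} {D′ = D′} refl _ _ _ _ _ = ⊥-elim (P∤E (≼-trans (P∣P^suc k D′) (divides Q e)))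

  unitary-^ : ∀ i {D} → ¬ P ≼ D → UnitaryDivisor (P ^ i) (P ^ i * D)
  unitary-^ i {D} P∤D = D , refl , coprime-^ i P∤D

  unitary-*^ : ∀ i {E D} → ¬ P ≼ D → UnitaryDivisor E D → UnitaryDivisor E (P ^ i * D)
  unitary-*^ i {E} P∤D (F , refl , coprime) = P ^ i * F , regroup E (P ^ i) F ,
    coprime-*^ i (λ d → P∤D (≼-*ʳ F d)) (λ d → P∤D (≼-*ˡ E d)) coprime
    where
    regroup : ∀ e p f → e * (p * f) ≡ p * (e * f)
    regroup = solve-∀ ring

  -- If i = j, then `P ^ i` is a common unitary divisor, and 1 ≤ i + j keeps it from being `one`.
  -- This is what excludes the middle exponent from bi-unitary divisors.
  ucoprime-split : ∀ i j {D Q} → 1 ≤ i ℕ.+ j → ¬ P ≼ D → ¬ P ≼ Q →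
                   UCoprime (P ^ i * D) (P ^ j * Q) → i ≢ j × UCoprime D Q
  ucoprime-split i j 1≤ P∤D P∤Q coprime =
    distinct i j 1≤ P∤Q coprime , λ E u v → coprime E (unitary-*^ i P∤D u) (unitary-*^ j P∤Q v)
    where
    distinct : ∀ i j {Q} → 1 ≤ i ℕ.+ j → ¬ P ≼ Q → UCoprime (P ^ i * _) (P ^ j * Q) → i ≢ j
    distinct (suc i) _ _ P∤Q coprime refl = irreducible∤one irr (subst (P ≼_)
      (coprime _ (unitary-^ (suc i) P∤D) (unitary-^ (suc i) P∤Q)) (divides (P ^ i) refl))

  -- The P-part of a unitary divisor is trivial or complete. A common unitary divisor E with
  -- nontrivial P-part would have it equal to both `P ^ i` and `P ^ j`, so i ≢ j leaves only
  -- divisors prime to P.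
  ucoprime-merge : ∀ i j {D Q} → ¬ P ≼ D → ¬ P ≼ Q → i ≢ j → UCoprime D Q → UCoprime (P ^ i * D) (P ^ j * Q)
  ucoprime-merge i j {D} {Q} P∤D P∤Q i≢j coprime E (F , e , EF) (G , e′ , EG) =
    go (split-factors i D E F P∤D e) (split-factors j Q E G P∤Q e′)
    where
    common : ∀ {k f E₁ F₁ F} → Coprime E F → E ≡ P ^ suc k * E₁ → F ≡ P ^ suc f * F₁ → ⊥
    common {k} {f} {E₁} {F₁} EF E≡ F≡ = proj₁ (proj₂ irr) (EF P
      (≼⇒∣ (subst (P ≼_) (sym E≡) (P∣P^suc k E₁))) (≼⇒∣ (subst (P ≼_) (sym F≡) (P∣P^suc f F₁))))
    go : SplitFactors i D E F → SplitFactors j Q E G → E ≡ one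
    go (splitFactors {zero} {f} {_} {F₁} refl refl P∤E _ _ eD) (splitFactors {l} {g} {_} {G₁} E≡ refl P∤E₂ _ _ eQ)
      with split-unique 0 l P∤E P∤E₂ E≡
    ... | refl , refl = coprime E
      (F₁ , eD , λ H H∣E H∣F → EF H H∣E (≼⇒∣ (≼-*ˡ (P ^ f) (∣⇒≼ {H} H∣F))))
      (G₁ , eQ , λ H H∣E H∣G → EG H H∣E (≼⇒∣ (≼-*ˡ (P ^ g) (∣⇒≼ {H} H∣G))))
    go (splitFactors {suc k} {suc f} E≡ F≡ _ _ _ _) _ = ⊥-elim (common {k} {f} EF E≡ F≡)
    go _ (splitFactors {suc l} {suc g} E≡ G≡ _ _ _ _) = ⊥-elim (common {l} {g} EG E≡ G≡)
    go (splitFactors {suc k} {zero} E≡ _ P∤E₁ _ i≡ _) (splitFactors {l} {g} E≡′ _ P∤E₂ _ j≡ _)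
      with split-unique (suc k) l P∤E₁ P∤E₂ (trans (sym E≡) E≡′)
    go (splitFactors {suc k} {zero} E≡ _ P∤E₁ _ i≡ _) (splitFactors {l} {zero} E≡′ _ P∤E₂ _ j≡ _)
      | k≡l , _ = ⊥-elim (i≢j (trans (sym i≡) (trans (cong (ℕ._+ 0) k≡l) j≡)))
    go (splitFactors {suc k} {zero} E≡ _ P∤E₁ _ i≡ _) (splitFactors {.(suc k)} {suc g} E≡′ G≡ P∤E₂ _ j≡ _)
      | refl , _ = ⊥-elim (common {k} {g} EG E≡′ G≡)

  powerSum : List ℕ → Poly
  powerSum es = sum (map (P ^_) es)

  products : List ℕ → List Poly → List Poly
  products = cartesianProductWith (λ i D → P ^ i * D)

  sum-products : ∀ es L → sum (products es L) ≡ powerSum es * sum L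
  sum-products []       L = refl
  sum-products (i ∷ es) L = begin
    sum (map (P ^ i *_) L ++ products es L)        ≡⟨ sum-++ (map (P ^ i *_) L) _ ⟩
    sum (map (P ^ i *_) L) + sum (products es L)   ≡⟨ cong₂ _+_ (sum-map-* (P ^ i) L) (sum-products es L) ⟩
    P ^ i * sum L + powerSum es * sum L            ≡⟨ *-distribʳ (sum L) (P ^ i) (powerSum es) ⟨
    powerSum (i ∷ es) * sum L                      ∎
    where open ≡-Reasoning

  unique-products : ∀ es L → Unique es → Unique L → (∀ D → D ∈ L → ¬ P ≼ D) → Unique (products es L)
  unique-products []       L _            _  _   = []
  unique-products (i ∷ es) L (i∉es ∷ ues) uL P∤L = Unique.++⁺
    (Unique.map⁺ (*-cancelˡ (^-nonzero i P≢𝟎)) uL) (unique-products es L ues uL P∤L) disjoint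
    where
    disjoint : ∀ {v} → v ∈ map (P ^ i *_) L × v ∈ products es L → ⊥
    disjoint (v∈₁ , v∈₂) with ∈-map⁻ (P ^ i *_) v∈₁ | ∈-cartesianProductWith⁻ (λ i D → P ^ i * D) es L v∈₂
    ... | D , D∈L , refl | j , D′ , j∈es , D′∈L , e with split-unique i j (P∤L D D∈L) (P∤L D′ D′∈L) e
    ...   | refl , _ = All¬⇒¬Any i∉es j∈es

  -- Multiplicativity of σ** at one prime. The list `es` holds the exponents i that differ from
  -- their complement a - i.
  sigma-step : ∀ {a B S} es → 1 ≤ a → Unique es → (∀ i → i ∈ es ⇔ ∃ λ j → i ℕ.+ j ≡ a × i ≢ j) →
               ¬ P ≼ B → SigmaBU≡ B S → SigmaBU≡ (P ^ a * B) (powerSum es * S)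
  sigma-step {a} {B} es 1≤a ues ∈es⇔ P∤B (L , uL , ∈L⇔ , refl) =
    products es L , unique-products es L ues uL P∤L , (λ D → mk⇔ (fwd D) (bwd D)) , sum-products es L
    where
    P∤L : ∀ D → D ∈ L → ¬ P ≼ D
    P∤L D D∈L P∣D with Equivalence.to (∈L⇔ D) D∈L
    ... | Q , e , _ = P∤B (≼-trans P∣D (divides Q e))
    fwd : ∀ D → D ∈ products es L → BiUnitaryDivisor D (P ^ a * B)
    fwd _ D∈ with ∈-cartesianProductWith⁻ (λ i D → P ^ i * D) es L D∈
    ... | i , D , i∈es , D∈L , refl with Equivalence.to (∈es⇔ i) i∈es | Equivalence.to (∈L⇔ D) D∈L
    ...   | j , refl , i≢j | Q , refl , coprime = P ^ j * Q , merge i j D Q ,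
      ucoprime-merge i j (P∤L D D∈L) (λ d → P∤B (≼-*ˡ D d)) i≢j coprime
    bwd : ∀ D → BiUnitaryDivisor D (P ^ a * B) → D ∈ products es L
    bwd D (Q , e , coprime) with split-factors a B D Q P∤B e
    ... | splitFactors {i} {j} {D′} {Q′} refl refl P∤D′ P∤Q′ refl eB with ucoprime-split i j 1≤a P∤D′ P∤Q′ coprime
    ...   | i≢j , coprime′ = ∈-cartesianProductWith⁺ (λ i D → P ^ i * D)
      (Equivalence.from (∈es⇔ i) (j , refl , i≢j)) (Equivalence.from (∈L⇔ D′) (Q′ , eB , coprime′))

-- Single-valuedness of σ**

sum-↭ : ∀ {xs ys} → xs ↭ ys → sum xs ≡ sum ys
sum-↭ ↭.refl         = refl
sum-↭ (↭.prep x p)   = cong (x +_) (sum-↭ p)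
sum-↭ (↭.swap x y p) = trans (rotate x y _) (cong (λ z → y + (x + z)) (sum-↭ p))
  where
  rotate : ∀ x y z → x + (y + z) ≡ y + (x + z)
  rotate = solve-∀ ring
sum-↭ (↭.trans p q)  = trans (sum-↭ p) (sum-↭ q)

-- Two duplicate-free lists with the same members are permutations of each other, and addition is
-- commutative. This lets the computed value of σ** be compared with A itself.
sigma-unique : ∀ {S T T′} → SigmaBU≡ S T → SigmaBU≡ S T′ → T ≡ T′
sigma-unique (L , uL , ∈L⇔ , refl) (L′ , uL′ , ∈L′⇔ , refl) = sum-↭ (∼bag⇒↭ (unique∧set⇒bag uL uL′ λ {D} →
  mk⇔ (λ D∈L → Equivalence.from (∈L′⇔ D) (Equivalence.to (∈L⇔ D) D∈L))
      (λ D∈L′ → Equivalence.from (∈L⇔ D) (Equivalence.to (∈L′⇔ D) D∈L′))))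

sigma-one : SigmaBU≡ one one
sigma-one = one ∷ [] , [] ∷ [] , (λ D → mk⇔ fwd bwd) , refl
  where
  fwd : ∀ {D} → D ∈ one ∷ [] → BiUnitaryDivisor D one
  fwd (here refl) = one , refl , λ { E (Q , e , _) _ → *≡one⇒≡one e }
  bwd : ∀ {D} → BiUnitaryDivisor D one → D ∈ one ∷ []
  bwd (Q , e , _) = here (*≡one⇒≡one e)

-- Geometric sums and σ** of a prime power

-- The second argument counts terms: `geom T n` is 1 + T + ⋯ + T^(n-1), so `geom T 0` is zero.
geom : Poly → ℕ → Poly
geom T zero    = 𝟎
geom T (suc n) = one + T * geom T n

geom-telescope : ∀ T n → (one + T) * geom T n ≡ one + T ^ n
geom-telescope T zero    = *-zeroʳ (one + T)
geom-telescope T (suc n) = trans (step T (geom T n)) (trans (cong (λ z → one + T + T * z) (geom-telescope T n)) (tidy T (T ^ n)))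
  where
  step : ∀ T g → (one + T) * (one + T * g) ≡ one + T + T * ((one + T) * g)
  step = solve-∀ ring
  tidy : ∀ T t → one + T + T * (one + t) ≡ one + T * t
  tidy = solve-∀ ring

geom-+ : ∀ T m n → geom T (m ℕ.+ n) ≡ geom T m + T ^ m * geom T n
geom-+ T zero    n = refl
geom-+ T (suc m) n = trans (cong (λ z → one + T * z) (geom-+ T m n)) (tidy T (geom T m) (T ^ m) (geom T n))
  where
  tidy : ∀ T g t h → one + T * (g + t * h) ≡ one + T * g + T * t * h
  tidy = solve-∀ ring

-- The second half of the sum is T^n times the first, and 1 + T^n is again 1 + T times that first
-- half. Doubling the length thus squares the sum up to one factor 1 + T, the source of all the
-- powers of 1 + T in σ**.
geom-double : ∀ T n → geom T (n ℕ.+ n) ≡ (one + T) * (geom T n * geom T n)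
geom-double T n = begin
  geom T (n ℕ.+ n)                       ≡⟨ geom-+ T n n ⟩
  geom T n + T ^ n * geom T n            ≡⟨ factor (geom T n) (T ^ n) ⟩
  (one + T ^ n) * geom T n               ≡⟨ cong (_* geom T n) (geom-telescope T n) ⟨
  (one + T) * geom T n * geom T n        ≡⟨ *-assoc (one + T) (geom T n) (geom T n) ⟩
  (one + T) * (geom T n * geom T n)      ∎
  where
  open ≡-Reasoning
  factor : ∀ g t → g + t * g ≡ (one + t) * g
  factor = solve-∀ ring

-- Exponents of bi-unitary divisors of a prime power

data Parity : ℕ → Set where
  even : ∀ n → Parity (n ℕ.+ n)
  odd  : ∀ n → Parity (suc (n ℕ.+ n))

parity : ∀ n → Parity n
parity zero    = even 0
parity (suc n) with parity n
... | even m = odd m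
... | odd m  = subst Parity (cong suc (ℕ.+-suc m m)) (even (suc m))

odd≢even : ∀ m n → suc (m ℕ.+ m) ≢ n ℕ.+ n
odd≢even m (suc n) e = odd≢even n m (sym (trans (ℕ.suc-injective e) (ℕ.+-suc n n)))

double-injective : ∀ m n → m ℕ.+ m ≡ n ℕ.+ n → m ≡ n
double-injective zero    zero    _ = refl
double-injective (suc m) (suc n) e = cong suc (double-injective m n
  (ℕ.suc-injective (trans (sym (ℕ.+-suc m m)) (trans (ℕ.suc-injective e) (ℕ.+-suc n n)))))

range : ℕ → ℕ → List ℕ
range k = applyUpTo (k ℕ.+_)

unique-range : ∀ k n → Unique (range k n)
unique-range k n = Unique.applyUpTo⁺₁ (k ℕ.+_) n λ i<j _ e → ℕ.<⇒≢ i<j (ℕ.+-cancelˡ-≡ k _ _ e)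

-- `applyUpTo` recurses by composing its function with `suc`; the induction therefore runs over
-- every f that agrees pointwise with the shift by k.
sum-^ : ∀ P (f : ℕ → ℕ) k n → (∀ i → f i ≡ k ℕ.+ i) → sum (map (P ^_) (applyUpTo f n)) ≡ P ^ k * geom P n
sum-^ P f k zero    _ = sym (*-zeroʳ (P ^ k))
sum-^ P f k (suc n) h = begin
  P ^ f 0 + sum (map (P ^_) (applyUpTo (λ i → f (suc i)) n))  ≡⟨ cong₂ _+_ (cong (P ^_) (trans (h 0) (ℕ.+-identityʳ k)))
                                                                  (sum-^ P (λ i → f (suc i)) (suc k) n (λ i → trans (h (suc i)) (ℕ.+-suc k i))) ⟩
  P ^ k + P * P ^ k * geom P n                                 ≡⟨ tidy P (P ^ k) (geom P n) ⟩
  P ^ k * (one + P * geom P n)                                 ∎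
  where
  open ≡-Reasoning
  tidy : ∀ P p g → p + P * p * g ≡ p * (one + P * g)
  tidy = solve-∀ ring

-- Only a/2 is its own complement, so all exponents from 0 to a occur for odd a and the middle one
-- is left out for even a.
exponents : ∀ {a} → Parity a → List ℕ
exponents (odd n)  = range 0 (suc (suc (n ℕ.+ n)))
exponents (even n) = range 0 n ++ range (suc n) n

unique-exponents : ∀ {a} (p : Parity a) → Unique (exponents p)
unique-exponents (odd n)  = unique-range 0 _
unique-exponents (even n) = Unique.++⁺ (unique-range 0 n) (unique-range (suc n) n) disjoint
  where
  disjoint : ∀ {v} → v ∈ range 0 n × v ∈ range (suc n) n → ⊥
  disjoint (v∈₁ , v∈₂) with ∈-applyUpTo⁻ (0 ℕ.+_) v∈₁ | ∈-applyUpTo⁻ (suc n ℕ.+_) v∈₂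
  ... | i , i<n , refl | j , _ , refl = ℕ.<-asym i<n (s≤s (ℕ.m≤m+n n j))

∈exponents⇔ : ∀ {a} (p : Parity a) i → i ∈ exponents p ⇔ ∃ λ j → i ℕ.+ j ≡ a × i ≢ j
∈exponents⇔ (odd n) i = mk⇔ fwd bwd
  where
  a : ℕ
  a = suc (n ℕ.+ n)
  fwd : i ∈ exponents (odd n) → ∃ λ j → i ℕ.+ j ≡ a × i ≢ j
  fwd i∈ with ∈-applyUpTo⁻ (0 ℕ.+_) i∈
  ... | i , s≤s i≤a , refl = a ℕ.∸ i , ℕ.m+[n∸m]≡n i≤a ,
    λ e → odd≢even n i (sym (trans (cong (i ℕ.+_) e) (ℕ.m+[n∸m]≡n i≤a)))
  bwd : (∃ λ j → i ℕ.+ j ≡ a × i ≢ j) → i ∈ exponents (odd n)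
  bwd (j , e , _) = ∈-applyUpTo⁺ (0 ℕ.+_) (s≤s (subst (i ≤_) e (ℕ.m≤m+n i j)))
∈exponents⇔ (even n) i = mk⇔ fwd bwd
  where
  complement : ∀ i → i ≤ n ℕ.+ n → i ≢ n → ∃ λ j → i ℕ.+ j ≡ n ℕ.+ n × i ≢ j
  complement i i≤2n i≢n = n ℕ.+ n ℕ.∸ i , ℕ.m+[n∸m]≡n i≤2n ,
    λ e → i≢n (double-injective i n (trans (cong (i ℕ.+_) e) (ℕ.m+[n∸m]≡n i≤2n)))
  fwd : i ∈ exponents (even n) → ∃ λ j → i ℕ.+ j ≡ n ℕ.+ n × i ≢ j
  fwd i∈ with ∈-++⁻ (range 0 n) i∈
  ... | inj₁ i∈₁ with ∈-applyUpTo⁻ (0 ℕ.+_) i∈₁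
  ...   | i , i<n , refl = complement i (ℕ.≤-trans (ℕ.<⇒≤ i<n) (ℕ.m≤m+n n n)) (ℕ.<⇒≢ i<n)
  fwd i∈ | inj₂ i∈₂ with ∈-applyUpTo⁻ (suc n ℕ.+_) i∈₂
  ...   | k , k<n , refl = complement (suc n ℕ.+ k) (subst (_≤ n ℕ.+ n) (ℕ.+-suc n k) (ℕ.+-monoʳ-≤ n k<n))
    (λ e → ℕ.<⇒≢ (s≤s (ℕ.m≤m+n n k)) (sym e))
  bwd : (∃ λ j → i ℕ.+ j ≡ n ℕ.+ n × i ≢ j) → i ∈ exponents (even n)
  bwd (j , e , i≢j) with ℕ.<-cmp i n
  ... | tri< i<n _ _ = ∈-++⁺ˡ (∈-applyUpTo⁺ (0 ℕ.+_) i<n)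
  ... | tri≈ _ refl _ = ⊥-elim (i≢j (sym (ℕ.+-cancelˡ-≡ i j i e)))
  ... | tri> _ _ n<i = ∈-++⁺ʳ (range 0 n) (subst (_∈ range (suc n) n) (ℕ.m+[n∸m]≡n n<i)
    (∈-applyUpTo⁺ (suc n ℕ.+_) (ℕ.+-cancelˡ-≤ n _ _ (subst (_≤ n ℕ.+ n) (sym shift) (subst (i ≤_) e (ℕ.m≤m+n i j))))))
    where
    shift : n ℕ.+ suc (i ℕ.∸ suc n) ≡ i
    shift = trans (ℕ.+-suc n _) (ℕ.m+[n∸m]≡n n<i)

-- For a = 2n, dropping P^n from the full sum leaves (1 + P^(n+1)) times the sum of length n, and 1
-- + P^(n+1) is 1 + P times the sum of length n + 1.
σ^ : ∀ {a} → Poly → Parity a → Poly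
σ^ P (odd n)  = geom P (suc (suc (n ℕ.+ n)))
σ^ P (even n) = (one + P) * (geom P n * geom P (suc n))

powerSum-exponents : ∀ P {a} (p : Parity a) → sum (map (P ^_) (exponents p)) ≡ σ^ P p
powerSum-exponents P (odd n)  = sum-^ P (0 ℕ.+_) 0 (suc (suc (n ℕ.+ n))) λ _ → refl
powerSum-exponents P (even n) = begin
  sum (map (P ^_) (range 0 n ++ range (suc n) n))                          ≡⟨ cong sum (map-++ (P ^_) (range 0 n) _) ⟩
  sum (map (P ^_) (range 0 n) ++ map (P ^_) (range (suc n) n))             ≡⟨ sum-++ (map (P ^_) (range 0 n)) _ ⟩
  sum (map (P ^_) (range 0 n)) + sum (map (P ^_) (range (suc n) n))        ≡⟨ cong₂ _+_ (sum-^ P (0 ℕ.+_) 0 n λ _ → refl) (sum-^ P (suc n ℕ.+_) (suc n) n λ _ → refl) ⟩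
  geom P n + P ^ suc n * geom P n                                          ≡⟨ factor (geom P n) (P ^ suc n) ⟩
  (one + P ^ suc n) * geom P n                                             ≡⟨ cong (_* geom P n) (geom-telescope P (suc n)) ⟨
  (one + P) * geom P (suc n) * geom P n                                    ≡⟨ regroup (one + P) (geom P (suc n)) (geom P n) ⟩
  (one + P) * (geom P n * geom P (suc n))                                  ∎
  where
  open ≡-Reasoning
  factor : ∀ g t → g + t * g ≡ (one + t) * g
  factor = solve-∀ ring
  regroup : ∀ p g h → p * g * h ≡ p * (h * g)
  regroup = solve-∀ ring

sigma-prime-power : ∀ {P a B S} → Irreducible P → 1 ≤ a → (p : Parity a) → ¬ P ≼ B →
                    SigmaBU≡ B S → SigmaBU≡ (P ^ a * B) (σ^ P p * S)
sigma-prime-power {P} {a} {B} {S} irr 1≤a p P∤B σB = subst (λ z → SigmaBU≡ (P ^ a * B) (z * S)) (powerSum-exponents P p)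
  (sigma-step irr (exponents p) 1≤a (unique-exponents p) (∈exponents⇔ p) P∤B σB)

-- For odd a the number of terms, 2n + 2, is even, and `geom-double` exhibits the factor.
one+∣σ^ : ∀ P {a} (p : Parity a) → one + P ≼ σ^ P p
one+∣σ^ P (even n) = divides _ refl
one+∣σ^ P (odd n)  = divides _ (sym (trans (cong (λ k → geom P (suc k)) (sym (ℕ.+-suc n n))) (geom-double P (suc n))))

-- Products of three prime powers

irreducible∤^ : ∀ {P Q} n → Irreducible P → Irreducible Q → P ≢ Q → ¬ P ≼ Q ^ n
irreducible∤^ {Q = Q} n irrP irrQ P≢Q d = P≢Q (irreducible-∣ irrP irrQ (euclid-^ Q n irrP d))

module _ {P Q R : Poly} (irrP : Irreducible P) (irrQ : Irreducible Q) (irrR : Irreducible R)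
         (P≢Q : P ≢ Q) (P≢R : P ≢ R) (Q≢R : Q ≢ R) where

  -- Products are nested to the right and end in `* one`, the shape reached by adding primes one by
  -- one to `sigma-one` or by removing them with `split-factors`.
  Q∤R^ : ∀ c → ¬ Q ≼ R ^ c * one
  Q∤R^ c = Valuation.∤-* irrQ (irreducible∤^ c irrQ irrR Q≢R) (irreducible∤one irrQ)

  P∤Q^*R^ : ∀ b c → ¬ P ≼ Q ^ b * (R ^ c * one)
  P∤Q^*R^ b c = Valuation.∤-* irrP (irreducible∤^ b irrP irrQ P≢Q)
    (Valuation.∤-* irrP (irreducible∤^ c irrP irrR P≢R) (irreducible∤one irrP))

  exponents-unique : ∀ a b c a′ b′ c′ → P ^ a * (Q ^ b * (R ^ c * one)) ≡ P ^ a′ * (Q ^ b′ * (R ^ c′ * one)) →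
                     a ≡ a′ × b ≡ b′ × c ≡ c′
  exponents-unique a b c a′ b′ c′ e
    with refl , e₁ ← Valuation.split-unique irrP a a′ (P∤Q^*R^ b c) (P∤Q^*R^ b′ c′) e
    with refl , e₂ ← Valuation.split-unique irrQ b b′ (Q∤R^ c) (Q∤R^ c′) e₁
    with refl , _ ← Valuation.split-unique irrR c c′ (irreducible∤one irrR) (irreducible∤one irrR) e₂
    = refl , refl , refl

  divisor-form : ∀ a b c {D} → D ≼ P ^ a * (Q ^ b * (R ^ c * one)) →
                 ∃ λ i → ∃₂ λ j k → D ≡ P ^ i * (Q ^ j * (R ^ k * one))
  divisor-form a b c {D} (divides E e)
    with Valuation.splitFactors {i} {_} {D₁} {E₁} refl _ _ _ _ e₁ ← Valuation.split-factors irrP a _ D E (P∤Q^*R^ b c) e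
    with Valuation.splitFactors {j} {_} {D₂} {E₂} refl _ _ _ _ e₂ ← Valuation.split-factors irrQ b _ D₁ E₁ (Q∤R^ c) e₁
    with Valuation.splitFactors {k} {_} {D₃} {E₃} refl _ _ _ _ e₃ ← Valuation.split-factors irrR c _ D₂ E₂ (irreducible∤one irrR) e₂
    = i , j , k , cong (λ z → P ^ i * (Q ^ j * (R ^ k * z))) (*≡one⇒≡one e₃)

  -- Once the full powers of P, Q and R are split off, the cofactor has no irreducible divisor left
  -- and is `one`. Each of the three primes divides A, which makes the exponents successors.
  factorisation : ∀ {A} → A ≢ 𝟎 → P ≼ A → Q ≼ A → R ≼ A →
                  (∀ S → Irreducible S → S ≼ A → S ≡ P ⊎ S ≡ Q ⊎ S ≡ R) →
                  ∃ λ a → ∃₂ λ b c → A ≡ P ^ suc a * (Q ^ suc b * (R ^ suc c * one))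
  factorisation {A} A≢0 P∣A Q∣A R∣A only
    with a , A₁ , e₁ , P∤A₁ ← Valuation.split irrP A A≢0
    with b , A₂ , refl , Q∤A₂ ← Valuation.split irrQ A₁ (λ { refl → P∤A₁ ≼-𝟎 })
    with c , A₃ , refl , R∤A₃ ← Valuation.split irrR A₂ (λ { refl → Q∤A₂ ≼-𝟎 })
    = positive a b c e₁ A₃≡1
    where
    A₃≡1 : A₃ ≡ one
    A₃≡1 = no-irreducible-divisor⇒one A₃ (λ { refl → R∤A₃ ≼-𝟎 }) (λ S irr S∣A₃ →
      [ (λ { refl → P∤A₁ (≼-*ˡ (Q ^ b) (≼-*ˡ (R ^ c) S∣A₃)) })
      , [ (λ { refl → Q∤A₂ (≼-*ˡ (R ^ c) S∣A₃) }) , (λ { refl → R∤A₃ S∣A₃ }) ]′ ]′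
      (only S irr (subst (S ≼_) (sym e₁) (≼-*ˡ (P ^ a) (≼-*ˡ (Q ^ b) (≼-*ˡ (R ^ c) S∣A₃))))))
    positive : ∀ a b c → A ≡ P ^ a * (Q ^ b * (R ^ c * A₃)) → A₃ ≡ one →
               ∃ λ a → ∃₂ λ b c → A ≡ P ^ suc a * (Q ^ suc b * (R ^ suc c * one))
    positive zero b c e refl = ⊥-elim (P∤Q^*R^ b c (subst (P ≼_) e P∣A))
    positive a@(suc _) zero c e refl = ⊥-elim (Valuation.∤-* irrQ
      (irreducible∤^ a irrQ irrP (λ e → P≢Q (sym e))) (Q∤R^ c) (subst (Q ≼_) e Q∣A))
    positive a@(suc _) b@(suc _) zero e refl = ⊥-elim (Valuation.∤-* irrR
      (irreducible∤^ a irrR irrP (λ e → P≢R (sym e))) (Valuation.∤-* irrR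
      (irreducible∤^ b irrR irrQ (λ e → Q≢R (sym e))) (irreducible∤one irrR)) (subst (R ≼_) e R∣A))
    positive (suc a) (suc b) (suc c) e refl = a , b , c , e

  σ-product : ∀ a b c (p : Parity (suc a)) (q : Parity (suc b)) (r : Parity (suc c)) {S} →
              SigmaBU≡ (P ^ suc a * (Q ^ suc b * (R ^ suc c * one))) S →
              S ≡ σ^ P p * (σ^ Q q * (σ^ R r * one))
  σ-product a b c p q r σ = sigma-unique σ
    (sigma-prime-power irrP (s≤s z≤n) p (P∤Q^*R^ (suc b) (suc c))
      (sigma-prime-power irrQ (s≤s z≤n) q (Q∤R^ (suc c))
        (sigma-prime-power irrR (s≤s z≤n) r (irreducible∤one irrR) sigma-one)))

-- The derivative

derivP : P⁺ → Poly
derivP 𝟏        = 𝟎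
derivP (b ∷ₚ p) = ⟨ p ⟩ + cons false (derivP p)

deriv : Poly → Poly
deriv 𝟎     = 𝟎
deriv ⟨ p ⟩ = derivP p

deriv-cons : ∀ b f → deriv (cons b f) ≡ f + cons false (deriv f)
deriv-cons false 𝟎     = refl
deriv-cons true  𝟎     = refl
deriv-cons false ⟨ p ⟩ = refl
deriv-cons true  ⟨ p ⟩ = refl

deriv-+ : ∀ f g → deriv (f + g) ≡ deriv f + deriv g
deriv-+ = poly-induction _ (λ _ → refl) λ b f ih → poly-induction _
  (trans (cong deriv (+-identityʳ (cons b f))) (sym (+-identityʳ _)))
  λ c g _ → begin
    deriv (cons b f + cons c g)                                      ≡⟨ cong deriv (cons-+ b c f g) ⟩
    deriv (cons (b xor c) (f + g))                                   ≡⟨ deriv-cons (b xor c) (f + g) ⟩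
    f + g + cons false (deriv (f + g))                               ≡⟨ cong (λ z → f + g + cons false z) (ih g) ⟩
    f + g + cons false (deriv f + deriv g)                           ≡⟨ cong (f + g +_) (cons-+ false false (deriv f) (deriv g)) ⟨
    (f + g) + (cons false (deriv f) + cons false (deriv g))          ≡⟨ +-interchange f g _ _ ⟩
    (f + cons false (deriv f)) + (g + cons false (deriv g))          ≡⟨ cong₂ _+_ (deriv-cons b f) (deriv-cons c g) ⟨
    deriv (cons b f) + deriv (cons c g)                              ∎
  where open ≡-Reasoning

deriv-· : ∀ b f → deriv (b · f) ≡ b · deriv f
deriv-· false f = refl
deriv-· true  f = refl

deriv-* : ∀ f g → deriv (f * g) ≡ deriv f * g + f * deriv g
deriv-* f g = poly-induction (λ f → deriv (f * g) ≡ deriv f * g + f * deriv g) refl step f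
  where
  open ≡-Reasoning
  regroup : ∀ a b c d → a + (b + (c + d)) ≡ (b + c) + (a + d)
  regroup = solve-∀ ring
  step : ∀ b f → deriv (f * g) ≡ deriv f * g + f * deriv g →
         deriv (cons b f * g) ≡ deriv (cons b f) * g + cons b f * deriv g
  step b f ih = begin
    deriv (cons b f * g)                                                            ≡⟨ cong deriv (cons-* b f g) ⟩
    deriv (b · g + cons false (f * g))                                              ≡⟨ deriv-+ (b · g) _ ⟩
    deriv (b · g) + deriv (cons false (f * g))                                      ≡⟨ cong₂ _+_ (deriv-· b g) (deriv-cons false (f * g)) ⟩
    b · deriv g + (f * g + cons false (deriv (f * g)))                              ≡⟨ cong (λ z → b · deriv g + (f * g + cons false z)) ih ⟩
    b · deriv g + (f * g + cons false (deriv f * g + f * deriv g))                  ≡⟨ cong (λ z → b · deriv g + (f * g + z)) (cons-+ false false (deriv f * g) _) ⟨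
    b · deriv g + (f * g + (cons false (deriv f * g) + cons false (f * deriv g)))   ≡⟨ regroup (b · deriv g) (f * g) _ _ ⟩
    (f * g + cons false (deriv f * g)) + (b · deriv g + cons false (f * deriv g))   ≡⟨ cong₂ _+_ (cong (f * g +_) (cons-* false (deriv f) g)) (cons-* b f (deriv g)) ⟨
    (f * g + cons false (deriv f) * g) + cons b f * deriv g                         ≡⟨ cong (_+ cons b f * deriv g) (*-distribʳ g f _) ⟨
    (f + cons false (deriv f)) * g + cons b f * deriv g                             ≡⟨ cong (λ z → z * g + cons b f * deriv g) (deriv-cons b f) ⟨
    deriv (cons b f) * g + cons b f * deriv g                                       ∎

deriv-square : ∀ f → deriv (f * f) ≡ 𝟎
deriv-square f = trans (deriv-* f f) (vanish (deriv f) f)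
  where
  vanish : ∀ d f → d * f + f * d ≡ 𝟎
  vanish = solve-∀ ring

-- one + T ^ m is squarefree for odd m, because its derivative T ^ (m - 1) is prime to it.
odd-squarefree : ∀ {T P} → deriv T ≡ one → Irreducible T → Irreducible P → P ≢ T →
                 ∀ n → ¬ P * P ≼ one + T ^ suc (n ℕ.+ n)
odd-squarefree {T} {P} T′ irrT irrP P≢T n (divides W e) =
  -- The derivative of a square vanishes, so P divides the derivative of the multiple W of P², and
  -- that derivative is T^(2n).
  P≢T (irreducible-∣ irrP irrT (euclid-^ T (n ℕ.+ n) irrP (divides (P * deriv W) (begin
    P * (P * deriv W)                                     ≡⟨ *-assoc P P (deriv W) ⟨
    P * P * deriv W                                       ≡⟨ cong (λ z → z * W + P * P * deriv W) (deriv-square P) ⟨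
    deriv (P * P) * W + P * P * deriv W                   ≡⟨ deriv-* (P * P) W ⟨
    deriv (P * P * W)                                     ≡⟨ cong deriv e ⟩
    deriv (one + T * T ^ (n ℕ.+ n))                       ≡⟨ deriv-+ one (T * T ^ (n ℕ.+ n)) ⟩
    deriv (T * T ^ (n ℕ.+ n))                             ≡⟨ deriv-* T _ ⟩
    deriv T * T ^ (n ℕ.+ n) + T * deriv (T ^ (n ℕ.+ n))   ≡⟨ cong₂ (λ y z → y * T ^ (n ℕ.+ n) + T * z) T′ (trans (cong deriv (^-+ T n n)) (deriv-square (T ^ n))) ⟩
    T ^ (n ℕ.+ n) + T * 𝟎                                 ≡⟨ trans (cong (T ^ (n ℕ.+ n) +_) (*-zeroʳ T)) (+-identityʳ _) ⟩
    T ^ (n ℕ.+ n)                                         ∎))))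
  where open ≡-Reasoning

-- Powers of two and sums of odd length

pow2 : ℕ → ℕ
pow2 zero    = 1
pow2 (suc r) = pow2 r ℕ.+ pow2 r

-- The Mersenne number 2^r - 1, given by recursion so that no truncated subtraction enters.
mers : ℕ → ℕ
mers zero    = 0
mers (suc r) = suc (mers r ℕ.+ mers r)

pow2≡suc-mers : ∀ r → pow2 r ≡ suc (mers r)
pow2≡suc-mers zero    = refl
pow2≡suc-mers (suc r) = trans (cong₂ ℕ._+_ (pow2≡suc-mers r) (pow2≡suc-mers r)) (cong suc (ℕ.+-suc (mers r) (mers r)))

dyadic : ∀ n → 1 ≤ n → ∃₂ λ r m → n ≡ pow2 r ℕ.* suc (m ℕ.+ m)
dyadic n = go n n ℕ.≤-refl
  where
  go : ∀ b n → n ≤ b → 1 ≤ n → ∃₂ λ r m → n ≡ pow2 r ℕ.* suc (m ℕ.+ m)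
  go b n n≤b 1≤n with parity n
  go b .(suc (m ℕ.+ m)) n≤b 1≤n | odd m = 0 , m , sym (ℕ.*-identityˡ _)
  go (suc b) .(suc m ℕ.+ suc m) (s≤s n≤b) 1≤n | even (suc m)
    with r , k , e ← go b (suc m) (ℕ.≤-trans (subst (suc m ≤_) (sym (ℕ.+-suc m m)) (s≤s (ℕ.m≤m+n m m))) n≤b) (s≤s z≤n) =
    suc r , k , trans (cong₂ ℕ._+_ e e) (sym (ℕ.*-distribʳ-+ (suc (k ℕ.+ k)) (pow2 r) (pow2 r)))

-- Each use of `geom-double` takes the exponent e of 1 + T to 2e + 1; starting from 0 this gives 2^r
-- - 1.
geom-pow2 : ∀ T r m → geom T (pow2 r ℕ.* m) ≡ (one + T) ^ mers r * geom T m ^ pow2 r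
geom-pow2 T zero    m = trans (cong (geom T) (ℕ.*-identityˡ m)) (sym (*-identityʳ (geom T m)))
geom-pow2 T (suc r) m = begin
  geom T ((pow2 r ℕ.+ pow2 r) ℕ.* m)                           ≡⟨ cong (geom T) (ℕ.*-distribʳ-+ m (pow2 r) (pow2 r)) ⟩
  geom T (pow2 r ℕ.* m ℕ.+ pow2 r ℕ.* m)                       ≡⟨ geom-double T (pow2 r ℕ.* m) ⟩
  U * (geom T (pow2 r ℕ.* m) * geom T (pow2 r ℕ.* m))          ≡⟨ cong (λ z → U * (z * z)) (geom-pow2 T r m) ⟩
  U * (u * g * (u * g))                                        ≡⟨ regroup U u g ⟩
  U * (u * u) * (g * g)                                        ≡⟨ cong₂ (λ y z → U * y * z) (^-+ U (mers r) (mers r)) (^-+ (geom T m) (pow2 r) (pow2 r)) ⟨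
  U ^ mers (suc r) * geom T m ^ pow2 (suc r)                   ∎
  where
  open ≡-Reasoning
  U u g : Poly
  U = one + T
  u = U ^ mers r
  g = geom T m ^ pow2 r
  regroup : ∀ U u g → U * (u * g * (u * g)) ≡ U * (u * u) * (g * g)
  regroup = solve-∀ ring

geom∣geom-pow2 : ∀ T r m → geom T m ≼ geom T (pow2 r ℕ.* m)
geom∣geom-pow2 T r m = subst (geom T m ≼_) (sym (trans (geom-pow2 T r m) (cong (λ k → (one + T) ^ mers r * geom T m ^ k) (pow2≡suc-mers r))))
  (≼-*ˡ ((one + T) ^ mers r) (divides (geom T m ^ mers r) refl))

T∤geom : ∀ {T} n → Irreducible T → ¬ T ≼ geom T (suc n)
T∤geom {T} n irrT d = irreducible∤one irrT (≼-+-cancelˡ (T * geom T n) (divides _ refl)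
  (subst (T ≼_) (+-comm one (T * geom T n)) d))

-- geom T m ≡ m modulo one + T.
∤geom-odd : ∀ {T W} n → Irreducible W → W ≼ one + T → ¬ W ≼ geom T (suc (n ℕ.+ n))
∤geom-odd {T} {W} n irrW W∣ d = irreducible∤one irrW (≼-+-cancelˡ (T * geom T (n ℕ.+ n))
  (≼-*ˡ T (≼-trans W∣ (divides _ (sym (geom-double T n)))))
  (subst (W ≼_) (+-comm one (T * geom T (n ℕ.+ n))) d))

-- Multiplication by 1 + T turns the equation into T^m = T^n, whose exponents the T-adic valuation
-- reads off.
geom-injective : ∀ {T} m n → Irreducible T → geom T m ≡ geom T n → m ≡ n
geom-injective {T} m n irrT e = proj₁ (Valuation.split-unique irrT m n (irreducible∤one irrT) (irreducible∤one irrT)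
  (cong (_* one) (+-cancelˡ one {T ^ m} {T ^ n} (trans (sym (geom-telescope T m)) (trans (cong ((one + T) *_) e) (geom-telescope T n))))))
  where
  +-cancelˡ : ∀ f {g h} → f + g ≡ f + h → g ≡ h
  +-cancelˡ f {g} {h} e = trans (identity f g) (trans (cong (f +_) e) (sym (identity f h)))
    where
    identity : ∀ f g → g ≡ f + (f + g)
    identity = solve-∀ ring

-- Local factors σ**(T^a) whose prime divisors lie among T, U = 1 + T and P

-- Pure a: σ**(T^a) = U^a.  Mixed k a e α: σ**(T^a) = U^e P^α with P = 1 + T + ⋯ + T^(2^(k+1)).
data Pure : ℕ → Set where
  pure-two  : Pure 2
  pure-mers : ∀ r → Pure (mers (suc r))

data Mixed : (k a e α : ℕ) → Set where
  mixed-odd  : ∀ {k a} r → suc a ≡ pow2 (suc r) ℕ.* suc (pow2 (suc k)) → Mixed k a (mers (suc r)) (pow2 (suc r))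
  mixed-even : ∀ {k} → Mixed k (pow2 (suc k) ℕ.+ pow2 (suc k)) (pow2 (suc k)) 1
  mixed-six  : Mixed 0 6 4 1

geom-mers : ∀ T r → geom T (pow2 r) ≡ (one + T) ^ mers r
geom-mers T r = begin
  geom T (pow2 r)                                            ≡⟨ cong (geom T) (ℕ.*-identityʳ (pow2 r)) ⟨
  geom T (pow2 r ℕ.* 1)                                      ≡⟨ geom-pow2 T r 1 ⟩
  (one + T) ^ mers r * (one + T * 𝟎) ^ pow2 r                ≡⟨ cong (λ z → (one + T) ^ mers r * (one + z) ^ pow2 r) (*-zeroʳ T) ⟩
  (one + T) ^ mers r * one ^ pow2 r                          ≡⟨ cong ((one + T) ^ mers r *_) (one^ (pow2 r)) ⟩
  (one + T) ^ mers r * one                                   ≡⟨ *-identityʳ _ ⟩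
  (one + T) ^ mers r                                         ∎
  where open ≡-Reasoning

pure-odd : ∀ T a r → suc a ≡ pow2 (suc r) ℕ.* 1 → Pure a × geom T (suc a) ≡ (one + T) ^ a
pure-odd T a r e = subst Pure (sym a≡) (pure-mers r) ,
  trans (cong (geom T) (trans e (ℕ.*-identityʳ (pow2 (suc r))))) (trans (geom-mers T (suc r)) (cong ((one + T) ^_) (sym a≡)))
  where
  a≡ : a ≡ mers (suc r)
  a≡ = ℕ.suc-injective (trans e (trans (ℕ.*-identityʳ _) (pow2≡suc-mers (suc r))))

σ-two : ∀ T → (one + T) * (geom T 1 * geom T 2) ≡ (one + T) ^ 2
σ-two = identity
  where
  identity : ∀ T → (one + T) * ((one + T * 𝟎) * (one + T * (one + T * 𝟎))) ≡ (one + T) * ((one + T) * one)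
  identity = solve-∀ ring

Smooth : Poly → Poly → Poly → Poly → Set
Smooth T U P f = ∃ λ i → ∃₂ λ j k → f ≡ T ^ i * (U ^ j * (P ^ k * one))

-- T and U are X and X + 1 in either order; both instances are used. The hypothesis on 1 + P is
-- supplied by its divisibility into A.
module Side {T U P : Poly} (U≡ : one + T ≡ U) (T′ : deriv T ≡ one)
            (irrT : Irreducible T) (irrU : Irreducible U) (irrP : Irreducible P)
            (T≢U : T ≢ U) (T≢P : T ≢ P) (U≢P : U ≢ P)
            (smooth-one+P : Smooth T U P (one + P)) where

  smooth-∣ : ∀ {f g} → f ≼ g → Smooth T U P g → Smooth T U P f
  smooth-∣ f∣g (i , j , k , refl) = divisor-form irrT irrU irrP T≢U T≢P U≢P i j k f∣g

  -- Of the three admissible primes, T and U never divide a sum of odd length, and P divides it at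
  -- most once because its multiple 1 + T^(2n+1) is squarefree.
  geom-odd : ∀ n → Smooth T U P (geom T (suc (n ℕ.+ n))) → geom T (suc (n ℕ.+ n)) ≡ one ⊎ geom T (suc (n ℕ.+ n)) ≡ P
  geom-odd n (suc i , j , k , e) = ⊥-elim (T∤geom (n ℕ.+ n) irrT (subst (T ≼_) (sym e) (≼-*ʳ _ (divides (T ^ i) refl))))
  geom-odd n (zero , suc j , k , e) = ⊥-elim (∤geom-odd {T} n irrU (subst (U ≼_) (sym U≡) ≼-refl)
    (subst (U ≼_) (sym e) (≼-*ʳ _ (divides (U ^ j) refl))))
  geom-odd n (zero , zero , zero , e) = inj₁ e
  geom-odd n (zero , zero , suc zero , e) = inj₂ (trans e (trans (*-identityʳ _) (*-identityʳ P)))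
  geom-odd n (zero , zero , suc (suc k) , e) = ⊥-elim (odd-squarefree T′ irrT irrP (λ e → T≢P (sym e)) n
    (subst (P * P ≼_) (geom-telescope T (suc (n ℕ.+ n))) (≼-*ˡ (one + T)
      (subst (P * P ≼_) (sym e) (≼-*ʳ one (divides (P ^ k) (*-assoc P P (P ^ k))))))))

  geom≡one⇒ : ∀ n → geom T (suc (n ℕ.+ n)) ≡ one → n ≡ 0
  geom≡one⇒ n e = double-injective n 0 (ℕ.suc-injective (geom-injective (suc (n ℕ.+ n)) 1 irrT
    (trans e (sym (cong (one +_) (*-zeroʳ T))))))

  one≢P : one ≢ P
  one≢P refl = irreducible∤one irrP ≼-refl

  P∤one+P : ¬ P ≼ one + P
  P∤one+P d = irreducible∤one irrP (≼-+-cancelˡ P ≼-refl (subst (P ≼_) (+-comm one P) d))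

  one+geom : ∀ n → one + geom T (suc n) ≡ T * geom T n
  one+geom n = identity (T * geom T n)
    where
    identity : ∀ f → one + (one + f) ≡ f
    identity = solve-∀ ring

  -- Here 1 + P is T times the sum of length 2n. If m is the odd part of 2n, the sum of length m
  -- divides 1 + P, hence is 1 or P by `geom-odd`; P does not divide 1 + P, so m = 1.
  geom≡P⇒ : ∀ n → geom T (suc (n ℕ.+ n)) ≡ P → ∃ λ k → n ℕ.+ n ≡ pow2 (suc k)
  geom≡P⇒ zero    e = ⊥-elim (one≢P (trans (sym (cong (one +_) (*-zeroʳ T))) e))
  geom≡P⇒ (suc n) e = conclude (dyadic (suc n ℕ.+ suc n) (s≤s z≤n))
    where
    g∣one+P : ∀ r m → suc n ℕ.+ suc n ≡ pow2 r ℕ.* suc (m ℕ.+ m) → geom T (suc (m ℕ.+ m)) ≼ one + P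
    g∣one+P r m n≡ = subst (geom T (suc (m ℕ.+ m)) ≼_) (trans (sym (one+geom (suc n ℕ.+ suc n))) (cong (one +_) e))
      (≼-*ˡ T (subst (λ k → geom T (suc (m ℕ.+ m)) ≼ geom T k) (sym n≡) (geom∣geom-pow2 T r (suc (m ℕ.+ m)))))
    m≡0 : ∀ r m → suc n ℕ.+ suc n ≡ pow2 r ℕ.* suc (m ℕ.+ m) → m ≡ 0
    m≡0 r m n≡ = [ geom≡one⇒ m , (λ g≡P → ⊥-elim (P∤one+P (subst (_≼ one + P) g≡P (g∣one+P r m n≡)))) ]′
      (geom-odd m (smooth-∣ (g∣one+P r m n≡) smooth-one+P))
    power : ∀ r m → m ≡ 0 → suc n ℕ.+ suc n ≡ pow2 r ℕ.* suc (m ℕ.+ m) → ∃ λ k → suc n ℕ.+ suc n ≡ pow2 (suc k)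
    power zero    .0 refl n≡ = ⊥-elim (odd≢even 0 (suc n) (sym n≡))
    power (suc r) .0 refl n≡ = r , trans n≡ (ℕ.*-identityʳ (pow2 (suc r)))
    conclude : (∃₂ λ r m → suc n ℕ.+ suc n ≡ pow2 r ℕ.* suc (m ℕ.+ m)) → ∃ λ k → suc n ℕ.+ suc n ≡ pow2 (suc k)
    conclude (r , m , n≡) = power r m (m≡0 r m n≡) n≡

  Shape : ℕ → Poly → Set
  Shape a S = Pure a × S ≡ U ^ a ⊎
    ∃ λ k → ∃₂ λ e α → P ≡ geom T (suc (pow2 (suc k))) × Mixed k a e α × S ≡ U ^ e * P ^ α

  -- For odd a the odd part of a + 1 gives a sum that must be 1 or P, and `geom-pow2` restores the
  -- rest. For a = 2n exactly one of n and n + 1 is odd, and the sum of that length must be 1 or P.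
  σ-shape : ∀ {a} (p : Parity a) → 1 ≤ a → Smooth T U P (σ^ T p) → Shape a (σ^ T p)
  σ-shape (odd n) _ smooth = conclude (dyadic (suc a) (s≤s z≤n))
    where
    a : ℕ
    a = suc (n ℕ.+ n)
    g∣σ : ∀ r m → suc a ≡ pow2 r ℕ.* suc (m ℕ.+ m) → geom T (suc (m ℕ.+ m)) ≼ geom T (suc a)
    g∣σ r m a≡ = subst (λ k → geom T (suc (m ℕ.+ m)) ≼ geom T k) (sym a≡) (geom∣geom-pow2 T r (suc (m ℕ.+ m)))
    pure : ∀ r m → m ≡ 0 → suc a ≡ pow2 (suc r) ℕ.* suc (m ℕ.+ m) → Shape a (geom T (suc a))
    pure r .0 refl a≡ = inj₁ (proj₁ (pure-odd T a r a≡) , trans (proj₂ (pure-odd T a r a≡)) (cong (_^ a) U≡))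
    mixed : ∀ r m → geom T (suc (m ℕ.+ m)) ≡ P → (∃ λ k → m ℕ.+ m ≡ pow2 (suc k)) →
            suc a ≡ pow2 (suc r) ℕ.* suc (m ℕ.+ m) → Shape a (geom T (suc a))
    mixed r m g≡P (k , m≡) a≡ = inj₂ (k , _ , _ , trans (sym g≡P) (cong (λ m → geom T (suc m)) m≡) ,
      mixed-odd r (trans a≡ (cong (λ m → pow2 (suc r) ℕ.* suc m) m≡)) ,
      trans (cong (geom T) a≡) (trans (geom-pow2 T (suc r) (suc (m ℕ.+ m)))
        (cong₂ (λ y z → y ^ mers (suc r) * z ^ pow2 (suc r)) U≡ g≡P)))
    conclude : (∃₂ λ r m → suc a ≡ pow2 r ℕ.* suc (m ℕ.+ m)) → Shape a (geom T (suc a))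
    conclude (zero  , m , a≡) = ⊥-elim (odd≢even n m (ℕ.suc-injective (trans a≡ (ℕ.*-identityˡ _))))
    conclude (suc r , m , a≡) = [ (λ g≡1 → pure r m (geom≡one⇒ m g≡1) a≡) , (λ g≡P → mixed r m g≡P (geom≡P⇒ m g≡P) a≡) ]′
      (geom-odd m (smooth-∣ (g∣σ (suc r) m a≡) smooth))
  σ-shape (even n) 1≤a smooth = go (parity n) 1≤a smooth
    where
    product : ℕ → Poly
    product n = (one + T) * (geom T n * geom T (suc n))
    even-one : ∀ t → t ≡ 0 → 1 ≤ (t ℕ.+ t) ℕ.+ (t ℕ.+ t) → ⊥
    even-one .0 refl ()
    -- Now n = t + t is itself a power of two, so the other sum, of length n, is a power of 1 + T.
    even-P : ∀ t → geom T (suc (t ℕ.+ t)) ≡ P → (∃ λ k → t ℕ.+ t ≡ pow2 (suc k)) →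
             Shape ((t ℕ.+ t) ℕ.+ (t ℕ.+ t)) (product (t ℕ.+ t))
    even-P t g≡P (k , t≡) = inj₂ (k , _ , _ , trans (sym g≡P) (cong (λ m → geom T (suc m)) t≡) ,
      subst (λ m → Mixed k (m ℕ.+ m) m 1) (sym t≡) mixed-even , (begin
        (one + T) * (geom T (t ℕ.+ t) * geom T (suc (t ℕ.+ t)))    ≡⟨ cong₂ (λ y z → (one + T) * (y * z)) (trans (cong (geom T) t≡) (geom-mers T (suc k))) g≡P ⟩
        (one + T) * ((one + T) ^ mers (suc k) * P)                 ≡⟨ *-assoc (one + T) ((one + T) ^ mers (suc k)) P ⟨
        (one + T) ^ suc (mers (suc k)) * P                         ≡⟨ cong₂ _*_ (cong₂ _^_ U≡ (trans (sym (pow2≡suc-mers (suc k))) (sym t≡))) (sym (*-identityʳ P)) ⟩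
        U ^ (t ℕ.+ t) * P ^ 1                                      ∎))
      where open ≡-Reasoning
    odd-one : ∀ t → t ≡ 0 → Shape (suc (t ℕ.+ t) ℕ.+ suc (t ℕ.+ t)) (product (suc (t ℕ.+ t)))
    odd-one .0 refl = inj₁ (pure-two , trans (σ-two T) (cong (_^ 2) U≡))
    six-σ : ∀ T g → (one + T) * (g * geom T 4) ≡ (one + T) ^ 4 * (g * one)
    six-σ = identity
      where
      identity : ∀ T g → (one + T) * (g * (one + T * (one + T * (one + T * (one + T * 𝟎))))) ≡
                         (one + T) * ((one + T) * ((one + T) * ((one + T) * one))) * (g * one)
      identity = solve-∀ ring
    h∣product : ∀ t → geom T (suc t) ≼ product (suc (t ℕ.+ t))
    h∣product t = ≼-*ˡ (one + T) (≼-*ˡ (geom T (suc (t ℕ.+ t)))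
      (subst (λ m → geom T (suc t) ≼ geom T (suc m)) (ℕ.+-suc t t)
        (subst (geom T (suc t) ≼_) (sym (geom-double T (suc t))) (≼-*ˡ (one + T) (≼-*ˡ (geom T (suc t)) ≼-refl)))))
    -- With n = 2^(k+1) + 1 the sum of length n + 1 contains the one of length 2^k + 1. For k ≥ 1
    -- that length is odd, greater than 1 and less than n, so the sum is neither 1 nor P. Only k =
    -- 0, that is a = 6, survives.
    six : ∀ k → geom T (suc (pow2 (suc k))) ≡ P → Smooth T U P (product (suc (pow2 (suc k)))) →
          Shape (suc (pow2 (suc k)) ℕ.+ suc (pow2 (suc k))) (product (suc (pow2 (suc k))))
    six zero    g≡P _ = inj₂ (0 , 4 , 1 , sym g≡P , mixed-six , trans (six-σ T (geom T 3)) (cong₂ (λ y z → y ^ 4 * z ^ 1) U≡ g≡P))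
    six (suc k) g≡P smooth = ⊥-elim ([
      (λ h≡1 → ℕ.1+n≢0 (trans (sym (pow2≡suc-mers k)) (geom≡one⇒ (pow2 k) h≡1))) ,
      (λ h≡P → ℕ.m+1+n≢m (pow2 (suc k)) (trans (cong (pow2 (suc k) ℕ.+_) (sym (pow2≡suc-mers (suc k)))) (ℕ.suc-injective
          (geom-injective (suc (pow2 (suc (suc k)))) (suc (pow2 (suc k))) irrT (trans g≡P (sym h≡P)))))) ]′
      (geom-odd (pow2 k) (smooth-∣ (h∣product (pow2 (suc k))) smooth)))
    odd-P : ∀ t → geom T (suc (t ℕ.+ t)) ≡ P → (∃ λ k → t ℕ.+ t ≡ pow2 (suc k)) →
            Smooth T U P (product (suc (t ℕ.+ t))) → Shape (suc (t ℕ.+ t) ℕ.+ suc (t ℕ.+ t)) (product (suc (t ℕ.+ t)))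
    odd-P t g≡P (k , t≡) smooth = subst (λ m → geom T (suc m) ≡ P → Smooth T U P (product (suc m)) → Shape (suc m ℕ.+ suc m) (product (suc m)))
      (sym t≡) (six k) g≡P smooth
    go : ∀ {n} → Parity n → 1 ≤ n ℕ.+ n → Smooth T U P (product n) → Shape (n ℕ.+ n) (product n)
    go (even t) 1≤ smooth = [ (λ g≡1 → ⊥-elim (even-one t (geom≡one⇒ t g≡1) 1≤)) , (λ g≡P → even-P t g≡P (geom≡P⇒ t g≡P)) ]′
      (geom-odd t (smooth-∣ (≼-*ˡ (one + T) (≼-*ˡ (geom T (t ℕ.+ t)) ≼-refl)) smooth))
    go (odd t) 1≤ smooth = [ (λ g≡1 → odd-one t (geom≡one⇒ t g≡1)) , (λ g≡P → odd-P t g≡P (geom≡P⇒ t g≡P) smooth) ]′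
      (geom-odd t (smooth-∣ (≼-*ˡ (one + T) (≼-*ʳ (geom T (suc (suc (t ℕ.+ t)))) ≼-refl)) smooth))

  module _ (T∣one+P : T ≼ one + P) (U∣one+P : U ≼ one + P) where

    -- The squarefreeness argument needs derivative 1, which P need not have. Instead T and U divide
    -- 1 + P, and so none of T, U and P divides a sum of odd length in P.
    geom-P-odd : ∀ n → Smooth T U P (geom P (suc (n ℕ.+ n))) → n ≡ 0
    geom-P-odd n (suc i , j , k , e) = ⊥-elim (∤geom-odd {P} n irrT T∣one+P (subst (T ≼_) (sym e) (≼-*ʳ _ (divides (T ^ i) refl))))
    geom-P-odd n (zero , suc j , k , e) = ⊥-elim (∤geom-odd {P} n irrU U∣one+P (subst (U ≼_) (sym e) (≼-*ʳ _ (divides (U ^ j) refl))))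
    geom-P-odd n (zero , zero , suc k , e) = ⊥-elim (T∤geom (n ℕ.+ n) irrP (subst (P ≼_) (sym e) (≼-*ʳ one (divides (P ^ k) refl))))
    geom-P-odd n (zero , zero , zero , e) = double-injective n 0 (ℕ.suc-injective (geom-injective (suc (n ℕ.+ n)) 1 irrP
      (trans e (sym (cong (one +_) (*-zeroʳ P))))))

    σ-shape-P : ∀ {c} (p : Parity c) → 1 ≤ c → Smooth T U P (σ^ P p) → Pure c × σ^ P p ≡ (one + P) ^ c
    σ-shape-P (odd n) _ smooth = conclude (dyadic (suc c) (s≤s z≤n))
      where
      c : ℕ
      c = suc (n ℕ.+ n)
      pure : ∀ r m → m ≡ 0 → suc c ≡ pow2 (suc r) ℕ.* suc (m ℕ.+ m) → Pure c × geom P (suc c) ≡ (one + P) ^ c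
      pure r .0 refl c≡ = pure-odd P c r c≡
      conclude : (∃₂ λ r m → suc c ≡ pow2 r ℕ.* suc (m ℕ.+ m)) → Pure c × geom P (suc c) ≡ (one + P) ^ c
      conclude (zero  , m , c≡) = ⊥-elim (odd≢even n m (ℕ.suc-injective (trans c≡ (ℕ.*-identityˡ _))))
      conclude (suc r , m , c≡) = pure r m (geom-P-odd m (smooth-∣ (subst (λ k → geom P (suc (m ℕ.+ m)) ≼ geom P k) (sym c≡)
        (geom∣geom-pow2 P (suc r) (suc (m ℕ.+ m)))) smooth)) c≡
    σ-shape-P (even n) 1≤c smooth = go (parity n) 1≤c smooth
      where
      Goal : ℕ → Set
      Goal n = Pure (n ℕ.+ n) × (one + P) * (geom P n * geom P (suc n)) ≡ (one + P) ^ (n ℕ.+ n)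
      even-zero : ∀ t → t ≡ 0 → 1 ≤ (t ℕ.+ t) ℕ.+ (t ℕ.+ t) → ⊥
      even-zero .0 refl ()
      odd-zero : ∀ t → t ≡ 0 → Goal (suc (t ℕ.+ t))
      odd-zero .0 refl = pure-two , σ-two P
      go : ∀ {n} → Parity n → 1 ≤ n ℕ.+ n → Smooth T U P ((one + P) * (geom P n * geom P (suc n))) → Goal n
      go (even t) 1≤ smooth = ⊥-elim (even-zero t (geom-P-odd t (smooth-∣ (≼-*ˡ (one + P) (≼-*ˡ (geom P (t ℕ.+ t)) ≼-refl)) smooth)) 1≤)
      go (odd t)  1≤ smooth = odd-zero t (geom-P-odd t (smooth-∣ (≼-*ˡ (one + P) (≼-*ʳ (geom P (suc (suc (t ℕ.+ t)))) ≼-refl)) smooth))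

-- Monotonicity and products of powers of two

mers-mono : ∀ {m n} → m ≤ n → mers m ≤ mers n
mers-mono z≤n     = z≤n
mers-mono (s≤s h) = s≤s (ℕ.+-mono-≤ (mers-mono h) (mers-mono h))

pow2-mono : ∀ {m n} → m ≤ n → pow2 m ≤ pow2 n
pow2-mono {m} {n} h = subst₂≤ (pow2≡suc-mers m) (pow2≡suc-mers n) (s≤s (mers-mono h))
  where
  subst₂≤ : ∀ {a b c d} → a ≡ c → b ≡ d → c ≤ d → a ≤ b
  subst₂≤ refl refl h = h

pow2-+ : ∀ m n → pow2 (m ℕ.+ n) ≡ pow2 m ℕ.* pow2 n
pow2-+ zero    n = sym (ℕ.*-identityˡ (pow2 n))
pow2-+ (suc m) n = trans (cong₂ ℕ._+_ (pow2-+ m n) (pow2-+ m n)) (sym (ℕ.*-distribʳ-+ (pow2 n) (pow2 m) (pow2 m)))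

-- Irreducibility of 1 + T + ⋯ + T ^ (2 ^ K)

module Trace {T : Poly} (size-T : size T ≡ 2) where

  T≢𝟎 : T ≢ 𝟎
  T≢𝟎 e = ℕ.0≢1+n (trans (cong size (sym e)) size-T)

  -- T is not a unit. Every nonvanishing claim in `large-reducible` is brought to this form after
  -- dividing out a power of T.
  one+T*≢𝟎 : ∀ Z → one + T * Z ≢ 𝟎
  one+T*≢𝟎 Z e = ⊥-elim (T≢one (*≡one⇒≡one (sym (+≡𝟎⇒≡ one (T * Z) e))))
    where
    T≢one : T ≢ one
    T≢one e = ℕ.0≢1+n (ℕ.suc-injective (trans (cong size (sym e)) size-T))

  size-T* : ∀ {f} → f ≢ 𝟎 → size (T * f) ≡ suc (size f)
  size-T* {f} f≢0 = ℕ.suc-injective (trans (size-* T≢𝟎 f≢0) (cong (ℕ._+ size f) size-T))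

  size-T^ : ∀ n → size (T ^ n) ≡ suc n
  size-T^ zero    = refl
  size-T^ (suc n) = trans (size-T* (^-nonzero n T≢𝟎)) (cong suc (size-T^ n))

  size-one+ : ∀ {f} → 2 ≤ size f → size (one + f) ≡ size f
  size-one+ {⟨ 𝟏 ⟩}      (s≤s ())
  size-one+ {⟨ b ∷ₚ p ⟩} _ = refl

  size-geom : ∀ n → size (geom T (suc n)) ≡ suc n
  size-geom zero    = cong (λ z → size (one + z)) (*-zeroʳ T)
  size-geom (suc n) = trans (size-one+ (subst (2 ≤_) (sym s) (s≤s (s≤s z≤n)))) s
    where
    s : size (T * geom T (suc n)) ≡ suc (suc n)
    s = trans (size-T* (λ e → ℕ.1+n≢0 (trans (sym (size-geom n)) (cong size e)))) (cong suc (size-geom n))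

  -- The sum of T^(2^i) over m ≤ i < m + n. The starting point is a parameter because the halves i <
  -- K and i ≥ K are reduced modulo P in different ways.
  trace : ℕ → ℕ → Poly
  trace m zero    = 𝟎
  trace m (suc n) = trace m n + T ^ pow2 (m ℕ.+ n)

  trace-+ : ∀ m n → trace 0 (m ℕ.+ n) ≡ trace 0 m + trace m n
  trace-+ m zero    = trans (cong (trace 0) (ℕ.+-identityʳ m)) (sym (+-identityʳ (trace 0 m)))
  trace-+ m (suc n) = trans (cong (trace 0) (ℕ.+-suc m n))
    (trans (cong (_+ T ^ pow2 (m ℕ.+ n)) (trace-+ m n)) (+-assoc (trace 0 m) _ _))

  -- Squaring moves each T^(2^i) to its successor, so t² + t telescopes.
  trace-artinSchreier : ∀ n → trace 0 n * (trace 0 n + one) ≡ T + T ^ pow2 n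
  trace-artinSchreier zero    = sym (≡⇒+≡𝟎 (sym (*-identityʳ T)))
  trace-artinSchreier (suc n) = begin
    (t + s) * (t + s + one)             ≡⟨ expand t s ⟩
    t * (t + one) + (s + s * s)         ≡⟨ cong (_+ (s + s * s)) (trace-artinSchreier n) ⟩
    T + s + (s + s * s)                 ≡⟨ tidy T s ⟩
    T + s * s                           ≡⟨ cong (T +_) (^-+ T (pow2 n) (pow2 n)) ⟨
    T + T ^ pow2 (suc n)                ∎
    where
    open ≡-Reasoning
    t s : Poly
    t = trace 0 n
    s = T ^ pow2 n
    expand : ∀ t s → (t + s) * (t + s + one) ≡ t * (t + one) + (s + s * s)
    expand = solve-∀ ring
    tidy : ∀ T s → T + s + (s + s * s) ≡ T + s * s
    tidy = solve-∀ ring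

  -- With N = 2 ^ K ≥ 8 and P = 1 + T + ⋯ + T ^ N, one has T ^ (N + 1) ≡ 1 modulo P, so the trace
  -- t = ∑ T ^ (2 ^ i), i < 2K, satisfies t * (t + 1) ≡ 0. Reduced modulo P it has degree at most N and
  -- starts with T + T² + 0 T³, so neither it nor t + 1 is a multiple of P.
  module _ (k : ℕ) (irrP : Irreducible (geom T (suc (pow2 (3 ℕ.+ k))))) where

    K N : ℕ
    K = 3 ℕ.+ k
    N = pow2 K

    P Y : Poly
    P = geom T (suc N)
    Y = T ^ suc N

    P∣one+Y^ : ∀ m → P ≼ one + Y ^ m
    P∣one+Y^ m = ≼-trans (divides (one + T) (trans (*-comm P (one + T)) (geom-telescope T (suc N))))
      (divides (geom Y m) (geom-telescope Y m))

    T^-reduce : ∀ {a} m l → a ≡ suc N ℕ.* m ℕ.+ l → P ≼ T ^ a + T ^ l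
    T^-reduce {a} m l e = subst (P ≼_) (begin
      (one + Y ^ m) * T ^ l             ≡⟨ expand (Y ^ m) (T ^ l) ⟩
      Y ^ m * T ^ l + T ^ l             ≡⟨ cong (λ z → z * T ^ l + T ^ l) (^-* T (suc N) m) ⟨
      T ^ (suc N ℕ.* m) * T ^ l + T ^ l ≡⟨ cong (_+ T ^ l) (trans (cong (T ^_) e) (^-+ T (suc N ℕ.* m) l)) ⟨
      T ^ a + T ^ l                     ∎) (≼-*ʳ (T ^ l) (P∣one+Y^ m))
      where
      open ≡-Reasoning
      expand : ∀ y t → (one + y) * t ≡ y * t + t
      expand = solve-∀ ring

    -- 2^(2K) = N² = (N + 1)(N - 1) + 1, so T^(2^(2K)) is congruent to T modulo P.
    P∣trace : P ≼ trace 0 (K ℕ.+ K) * (trace 0 (K ℕ.+ K) + one)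
    P∣trace = subst (P ≼_) (sym (trans (trace-artinSchreier (K ℕ.+ K)) (trans (+-comm T _) (cong (T ^ pow2 (K ℕ.+ K) +_) (sym (*-identityʳ T))))))
      (T^-reduce (mers K) 1 (trans (pow2-+ K K) (trans (cong (λ n → n ℕ.* n) (pow2≡suc-mers K))
        (trans (square (mers K)) (cong (λ n → suc n ℕ.* mers K ℕ.+ 1) (sym (pow2≡suc-mers K)))))))
      where
      square : ∀ m → suc m ℕ.* suc m ≡ suc (suc m) ℕ.* m ℕ.+ 1
      square = ℕ-Solver.solve-∀

    -- In the lower half the exponents 1, 2, 4, ... stay below N and need no reduction; from the
    -- third term on they are divisible by 4, and T^4 is split off.
    low : ∀ n → 2 ℕ.+ n ≤ K → ∃ λ W → trace 0 (2 ℕ.+ n) ≡ T + T * T + T ^ 4 * W × size (T ^ 4 * W) ≤ suc N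
    low zero    _ = 𝟎 , start T , subst (λ z → size z ≤ suc N) (sym (*-zeroʳ (T ^ 4))) z≤n
      where
      start : ∀ T → T * one + T * (T * one) ≡ T + T * T + T * (T * (T * (T * one))) * 𝟎
      start = solve-∀ ring
    low (suc n) h = extend (low n (ℕ.≤-trans (ℕ.n≤1+n _) h))
      where
      l : ℕ
      l = mers n ℕ.+ mers n ℕ.+ (mers n ℕ.+ mers n)
      pow≡ : pow2 (2 ℕ.+ n) ≡ 4 ℕ.+ l
      pow≡ = trans (cong (λ m → m ℕ.+ m ℕ.+ (m ℕ.+ m)) (pow2≡suc-mers n)) (four (mers n))
        where
        four : ∀ m → suc m ℕ.+ suc m ℕ.+ (suc m ℕ.+ suc m) ≡ 4 ℕ.+ (m ℕ.+ m ℕ.+ (m ℕ.+ m))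
        four = ℕ-Solver.solve-∀
      T^≡ : T ^ pow2 (2 ℕ.+ n) ≡ T ^ 4 * T ^ l
      T^≡ = trans (cong (T ^_) pow≡) (^-+ T 4 l)
      extend : (∃ λ W → trace 0 (2 ℕ.+ n) ≡ T + T * T + T ^ 4 * W × size (T ^ 4 * W) ≤ suc N) →
               ∃ λ W → trace 0 (3 ℕ.+ n) ≡ T + T * T + T ^ 4 * W × size (T ^ 4 * W) ≤ suc N
      extend (W , e , s) = W + T ^ l ,
        trans (cong₂ _+_ e T^≡) (collect (T + T * T) (T ^ 4) W (T ^ l)) ,
        subst (λ z → size z ≤ suc N) (sym (*-distribˡ (T ^ 4) W (T ^ l))) (size-+-≤ (T ^ 4 * W) _ s
          (subst (_≤ suc N) (sym (trans (cong size (sym T^≡)) (size-T^ (pow2 (2 ℕ.+ n)))))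
            (s≤s (pow2-mono (ℕ.≤-trans (ℕ.n≤1+n _) h)))))
        where
        collect : ∀ a b c d → a + b * c + b * d ≡ a + b * (c + d)
        collect = solve-∀ ring

    -- With m = 2^n - 1 one has 2^(K+n) = N(m + 1) = (N + 1)m + (N - m), so T^(2^(K+n)) reduces to
    -- T^(N-m). As N - m ≥ 4, the upper half leaves the four lowest coefficients alone.
    high : ∀ n → n ≤ K → ∃ λ W → P ≼ trace K n + T ^ 4 * W × size (T ^ 4 * W) ≤ suc N
    high zero    _ = 𝟎 , subst (P ≼_) (sym (*-zeroʳ (T ^ 4))) ≼-𝟎 , subst (λ z → size z ≤ suc N) (sym (*-zeroʳ (T ^ 4))) z≤n
    high (suc n) (s≤s h) = extend (high n (ℕ.≤-trans h (ℕ.n≤1+n _)))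
      where
      m l : ℕ
      m = mers n
      l = N ℕ.∸ (4 ℕ.+ m)
      m+4≤N : 4 ℕ.+ m ≤ N
      m+4≤N = begin
        4 ℕ.+ m                                   ≤⟨ ℕ.+-monoʳ-≤ 4 (mers-mono h) ⟩
        -- K ≥ 3 enters here through 3 = `mers 2` ≤ M; for K = 2 the bound 4 + m ≤ N fails at n = 1.
        4 ℕ.+ M                                   ≤⟨ ℕ.+-monoˡ-≤ M (s≤s (mers-mono {2} {2 ℕ.+ k} (s≤s (s≤s z≤n)))) ⟩
        suc M ℕ.+ M                               ≤⟨ ℕ.n≤1+n _ ⟩
        suc (mers K)                              ≡⟨ pow2≡suc-mers K ⟨
        N                                         ∎
        where
        open ℕ.≤-Reasoning
        M : ℕ
        M = mers (2 ℕ.+ k)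
      N≡ : N ≡ 4 ℕ.+ m ℕ.+ l
      N≡ = sym (ℕ.m+[n∸m]≡n m+4≤N)
      pow≡ : pow2 (K ℕ.+ n) ≡ suc N ℕ.* m ℕ.+ (4 ℕ.+ l)
      pow≡ = trans (pow2-+ K n) (trans (cong (N ℕ.*_) (pow2≡suc-mers n)) (regroup N m l N≡))
        where
        regroup : ∀ N m l → N ≡ 4 ℕ.+ m ℕ.+ l → N ℕ.* suc m ≡ suc N ℕ.* m ℕ.+ (4 ℕ.+ l)
        regroup .(4 ℕ.+ m ℕ.+ l) m l refl = identity m l
          where
          identity : ∀ m l → (4 ℕ.+ m ℕ.+ l) ℕ.* suc m ≡ suc (4 ℕ.+ m ℕ.+ l) ℕ.* m ℕ.+ (4 ℕ.+ l)
          identity = ℕ-Solver.solve-∀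
      extend : (∃ λ W → P ≼ trace K n + T ^ 4 * W × size (T ^ 4 * W) ≤ suc N) →
               ∃ λ W → P ≼ trace K (suc n) + T ^ 4 * W × size (T ^ 4 * W) ≤ suc N
      extend (W , d , s) = W + T ^ l ,
        subst (P ≼_) (trans (cong (λ z → trace K n + T ^ 4 * W + (T ^ pow2 (K ℕ.+ n) + z)) (^-+ T 4 l))
          (collect (trace K n) (T ^ 4) W (T ^ pow2 (K ℕ.+ n)) (T ^ l))) (≼-+ d (T^-reduce m (4 ℕ.+ l) pow≡)) ,
        subst (λ z → size z ≤ suc N) (sym (*-distribˡ (T ^ 4) W (T ^ l))) (size-+-≤ (T ^ 4 * W) _ s
          (subst (_≤ suc N) (sym (trans (cong size (sym (^-+ T 4 l))) (size-T^ (4 ℕ.+ l))))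
            (s≤s (subst (4 ℕ.+ l ≤_) (sym N≡) (ℕ.+-monoʳ-≤ 4 (ℕ.m≤n+m l m))))))
        where
        collect : ∀ t b c u d → t + b * c + (u + b * d) ≡ t + u + b * (c + d)
        collect = solve-∀ ring

    -- The reduced trace may reach the degree N of P itself, so P has to be excluded along with
    -- zero.
    small-multiple : ∀ {R} → P ≼ R → size R ≤ suc N → R ≡ 𝟎 ⊎ R ≡ P
    small-multiple {R} (divides Q e) s with Q ≟ 𝟎
    ... | yes refl = inj₁ (trans (sym e) (*-zeroʳ P))
    ... | no Q≢0   = inj₂ (trans (sym e) (trans (cong (P *_) Q≡1) (*-identityʳ P)))
      where
      Q≡1 : Q ≡ one
      Q≡1 = size-≡1 Q≢0 (ℕ.+-cancelˡ-≤ (suc N) _ _ (begin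
        suc N ℕ.+ size Q    ≡⟨ cong (ℕ._+ size Q) (size-geom N) ⟨
        size P ℕ.+ size Q   ≡⟨ size-* (irreducible-nonzero irrP) Q≢0 ⟨
        suc (size (P * Q))  ≡⟨ cong (λ z → suc (size z)) e ⟩
        suc (size R)        ≤⟨ s≤s s ⟩
        suc (suc N)         ≡⟨ ℕ.+-comm 1 (suc N) ⟩
        suc N ℕ.+ 1         ∎))
        where open ℕ.≤-Reasoning

    -- The four lowest coefficients decide. R begins with T + T² + 0·T³, whereas P begins with 1 + T
    -- + T² + T³. So R differs from zero at T and from P at 1, while R + 1 differs from zero at 1
    -- and from P at T³.
    large-reducible : ⊥
    large-reducible = conclude (low (suc k) ℕ.≤-refl) (high K ℕ.≤-refl)
      where
      tail : ℕ
      tail = N ℕ.∸ 3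
      V : Poly
      V = geom T tail
      3≤N : 3 ≤ N
      3≤N = ℕ.≤-trans (s≤s (s≤s (s≤s z≤n))) (pow2-mono {3} {K} (s≤s (s≤s (s≤s z≤n))))
      P≡ : P ≡ geom T 4 + T ^ 4 * V
      P≡ = trans (cong (λ n → geom T (suc n)) (sym (ℕ.m+[n∸m]≡n 3≤N))) (geom-+ T 4 tail)
      module _ (W : Poly) (s : size (T ^ 4 * W) ≤ suc N) where
        R : Poly
        R = T + T * T + T ^ 4 * W
        size-R : size R ≤ suc N
        size-R = size-+-≤ (T + T * T) _ (size-+-≤ T (T * T) (subst (_≤ suc N) (sym size-T) (s≤s (ℕ.≤-trans (s≤s z≤n) 3≤N)))
          (subst (_≤ suc N) (sym (trans (size-T* T≢𝟎) (cong suc size-T))) (ℕ.≤-trans 3≤N (ℕ.n≤1+n N)))) s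
        P∤R : ¬ P ≼ R
        P∤R d = [ (λ e → *-nonzero T≢𝟎 (one+T*≢𝟎 (one + T * T * W)) (trans (factor T W) e))
                , (λ e → one+T*≢𝟎 _ (trans (factor′ T V W) (≡⇒+≡𝟎 (trans (sym P≡) (sym e))))) ]′ (small-multiple d size-R)
          where
          factor : ∀ T W → T * (one + T * (one + T * T * W)) ≡ T + T * T + T * (T * (T * (T * one))) * W
          factor = solve-∀ ring
          factor′ : ∀ T V W → one + T * (T * T + T * T * T * (V + W)) ≡
                    one + T * (one + T * (one + T * (one + T * 𝟎))) + T * (T * (T * (T * one))) * V + (T + T * T + T * (T * (T * (T * one))) * W)
          factor′ = solve-∀ ring
        P∤R+one : ¬ P ≼ R + one
        P∤R+one d = [ (λ e → one+T*≢𝟎 _ (trans (factor T W) e))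
                    , (λ e → *-nonzero (^-nonzero 3 T≢𝟎) (one+T*≢𝟎 (V + W)) (trans (factor′ T V W) (≡⇒+≡𝟎 (trans (sym P≡) (sym e))))) ]′
          (small-multiple d (size-+-≤ R one size-R (s≤s z≤n)))
          where
          factor : ∀ T W → one + T * (one + T + T * T * T * W) ≡ T + T * T + T * (T * (T * (T * one))) * W + one
          factor = solve-∀ ring
          factor′ : ∀ T V W → T * (T * (T * one)) * (one + T * (V + W)) ≡
                    one + T * (one + T * (one + T * (one + T * 𝟎))) + T * (T * (T * (T * one))) * V + (T + T * T + T * (T * (T * (T * one))) * W + one)
          factor′ = solve-∀ ring
      conclude : (∃ λ W → trace 0 (3 ℕ.+ k) ≡ T + T * T + T ^ 4 * W × size (T ^ 4 * W) ≤ suc N) →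
                 (∃ λ W → P ≼ trace K K + T ^ 4 * W × size (T ^ 4 * W) ≤ suc N) → ⊥
      conclude (W₁ , e , s₁) (W₂ , d , s₂) = [
          (λ P∣t → P∤R W s (subst (P ≼_) t+R (≼-+ P∣t d))) ,
          (λ P∣t+1 → P∤R+one W s (subst (P ≼_) t+1+R (≼-+ P∣t+1 d))) ]′
        (euclid (trace 0 (K ℕ.+ K)) _ irrP P∣trace)
        where
        W : Poly
        W = W₁ + W₂
        s : size (T ^ 4 * W) ≤ suc N
        s = subst (λ z → size z ≤ suc N) (sym (*-distribˡ (T ^ 4) W₁ W₂)) (size-+-≤ (T ^ 4 * W₁) _ s₁ s₂)
        t≡ : trace 0 (K ℕ.+ K) ≡ T + T * T + T ^ 4 * W₁ + trace K K
        t≡ = trans (trace-+ K K) (cong (_+ trace K K) e)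
        t+R : trace 0 (K ℕ.+ K) + (trace K K + T ^ 4 * W₂) ≡ T + T * T + T ^ 4 * W
        t+R = trans (cong (_+ (trace K K + T ^ 4 * W₂)) t≡) (cancel (T + T * T) (T ^ 4) W₁ W₂ (trace K K))
          where
          cancel : ∀ a b c d h → a + b * c + h + (h + b * d) ≡ a + b * (c + d)
          cancel = solve-∀ ring
        t+1+R : trace 0 (K ℕ.+ K) + one + (trace K K + T ^ 4 * W₂) ≡ T + T * T + T ^ 4 * W + one
        t+1+R = trans (shift (trace 0 (K ℕ.+ K)) _) (cong (_+ one) t+R)
          where
          shift : ∀ t u → t + one + u ≡ t + u + one
          shift = solve-∀ ring

-- The exponent equations

mers≢2 : ∀ r → mers r ≢ 2
mers≢2 (suc r) e = odd≢even 0 (mers r) (sym (ℕ.suc-injective e))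

-- Since c = α, it is 1 or a power of two, and 2 is the only even `Pure` number. Both c = 1 and c =
-- 2 lead to b = 2^(k+2) - 1, except that `mixed-six` gives b = 5, which is not `Pure`.
one-mixed : ∀ {k a e α b c} → Mixed k a e α → Pure b → Pure c → b ≡ e ℕ.+ mers (suc k) ℕ.* c → c ≡ α →
            b ≡ mers (suc (suc k)) × (c ≡ 1 ⊎ c ≡ 2)
one-mixed (mixed-odd r _) _ (pure-mers r′) _ c≡ = ⊥-elim (odd≢even (mers r′) (pow2 r) c≡)
one-mixed {k} (mixed-odd r _) _ pure-two b≡ c≡ =
  trans b≡ (trans (cong (ℕ._+ mers (suc k) ℕ.* 2) (ℕ.suc-injective (trans (sym (pow2≡suc-mers (suc r))) (sym c≡)))) (twice (mers (suc k)))) , inj₂ refl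
  where
  twice : ∀ m → 1 ℕ.+ m ℕ.* 2 ≡ suc (m ℕ.+ m)
  twice = ℕ-Solver.solve-∀
one-mixed {k} mixed-even _ _ b≡ refl =
  trans b≡ (cong₂ ℕ._+_ (pow2≡suc-mers (suc k)) (ℕ.*-identityʳ (mers (suc k)))) , inj₁ refl
one-mixed mixed-six pure-two _ () _
one-mixed mixed-six (pure-mers r) _ b≡ refl = ⊥-elim (mers≢2 r (double-injective (mers r) 2 (ℕ.suc-injective b≡)))

-- The exponents of X, X + 1 and M₁ in C₃, C₄, the conjugate of C₅, and C₅.
data TwoMixed : ℕ → ℕ → ℕ → Set where
  ⟨4,4,2⟩ : TwoMixed 4 4 2
  ⟨6,6,2⟩ : TwoMixed 6 6 2
  ⟨5,4,3⟩ : TwoMixed 5 4 3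
  ⟨4,5,3⟩ : TwoMixed 4 5 3

-- The sum is even and at least 4, but the only even `Pure` number is 2.
two-odd : ∀ r q {c} → Pure c → c ≡ pow2 (suc r) ℕ.+ pow2 (suc q) → ⊥
two-odd r q pure-two e = ℕ.0≢1+n (ℕ.suc-injective (ℕ.suc-injective (trans e (trans
  (cong₂ ℕ._+_ (pow2≡suc-mers (suc r)) (pow2≡suc-mers (suc q))) (shift (mers r) (mers q))))))
  where
  shift : ∀ m n → suc (suc (m ℕ.+ m)) ℕ.+ suc (suc (n ℕ.+ n)) ≡ suc (suc (suc (m ℕ.+ m ℕ.+ suc (n ℕ.+ n))))
  shift = ℕ-Solver.solve-∀
two-odd r q (pure-mers s) e = odd≢even (mers s) (pow2 r ℕ.+ pow2 q) (trans e (regroup (pow2 r) (pow2 q)))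
  where
  regroup : ∀ m n → m ℕ.+ m ℕ.+ (n ℕ.+ n) ≡ m ℕ.+ n ℕ.+ (m ℕ.+ n)
  regroup = ℕ-Solver.solve-∀

-- In terms of m = 2^(r+1) - 1 the equations say 3(m + 1) = f + m + 3. The cases needed are f = 2,
-- where m = 1, and f = 4, where m = 2 is not a Mersenne number.
odd-scale : ∀ r f {a c} → suc a ≡ pow2 (suc r) ℕ.* 3 → a ≡ f ℕ.+ c → c ≡ pow2 (suc r) ℕ.+ 1 →
            mers (suc r) ℕ.+ mers (suc r) ≡ f
odd-scale r f {a} a≡ a≡′ refl = solve (mers (suc r)) (trans (cong (ℕ._* 3) (sym (pow2≡suc-mers (suc r))))
  (trans (sym a≡) (cong suc (trans a≡′ (cong (λ p → f ℕ.+ (p ℕ.+ 1)) (pow2≡suc-mers (suc r)))))))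
  where
  solve : ∀ m → suc m ℕ.* 3 ≡ suc (f ℕ.+ (suc m ℕ.+ 1)) → m ℕ.+ m ≡ f
  solve m e = ℕ.+-cancelʳ-≡ (3 ℕ.+ m) (m ℕ.+ m) f (trans (left m) (trans e (right m f)))
    where
    left : ∀ m → m ℕ.+ m ℕ.+ (3 ℕ.+ m) ≡ suc m ℕ.* 3
    left = ℕ-Solver.solve-∀
    right : ∀ m f → suc (f ℕ.+ (suc m ℕ.+ 1)) ≡ f ℕ.+ (3 ℕ.+ m)
    right = ℕ-Solver.solve-∀

odd-even : ∀ r {a b c} → suc a ≡ pow2 (suc r) ℕ.* 3 → a ≡ 2 ℕ.+ c → b ≡ mers (suc r) ℕ.+ c → c ≡ pow2 (suc r) ℕ.+ 1 →
           a ≡ 5 × b ≡ 4 × c ≡ 3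
odd-even r {a} {b} {c} a≡ a≡′ b≡ c≡ = trans a≡′ (cong (2 ℕ.+_) c≡3) , trans b≡ (cong₂ ℕ._+_ m≡1 c≡3) , c≡3
  where
  m≡1 : mers (suc r) ≡ 1
  m≡1 = double-injective (mers (suc r)) 1 (odd-scale r 2 a≡ a≡′ c≡)
  c≡3 : c ≡ 3
  c≡3 = trans c≡ (cong (ℕ._+ 1) (trans (pow2≡suc-mers (suc r)) (cong suc m≡1)))

odd-six : ∀ r {a c} → suc a ≡ pow2 (suc r) ℕ.* 3 → a ≡ 4 ℕ.+ c → c ≡ pow2 (suc r) ℕ.+ 1 → ⊥
odd-six r a≡ a≡′ c≡ = mers≢2 (suc r) (double-injective (mers (suc r)) 2 (odd-scale r 4 a≡ a≡′ c≡))

two-mixed : ∀ {a e α b f β c} → Mixed 0 a e α → Mixed 0 b f β → Pure c →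
            a ≡ f ℕ.+ c → b ≡ e ℕ.+ c → c ≡ α ℕ.+ β → TwoMixed a b c
two-mixed (mixed-odd r _)  (mixed-odd q _)  pc _  _  c≡ = ⊥-elim (two-odd r q pc c≡)
two-mixed (mixed-odd r a≡) mixed-even       _  a≡′ b≡′ c≡ with odd-even r a≡ a≡′ b≡′ c≡
... | refl , refl , refl = ⟨5,4,3⟩
two-mixed (mixed-odd r a≡) mixed-six        _  a≡′ _ c≡ = ⊥-elim (odd-six r a≡ a≡′ c≡)
two-mixed mixed-even       (mixed-odd q b≡) _  a≡′ b≡′ c≡ with odd-even q b≡ b≡′ a≡′ (trans c≡ (ℕ.+-comm 1 (pow2 (suc q))))
... | refl , refl , refl = ⟨4,5,3⟩
two-mixed mixed-six        (mixed-odd q b≡) _  _ b≡′ c≡ = ⊥-elim (odd-six q b≡ b≡′ (trans c≡ (ℕ.+-comm 1 (pow2 (suc q)))))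
two-mixed mixed-even       mixed-even       _  _  _  refl = ⟨4,4,2⟩
two-mixed mixed-six        mixed-six        _  _  _  refl = ⟨6,6,2⟩
two-mixed mixed-even       mixed-six        _  () _  refl
two-mixed mixed-six        mixed-even       _  () _  refl

one+geom-pow2 : ∀ T U {P} k → one + T ≡ U → P ≡ geom T (suc (pow2 (suc k))) → one + P ≡ T * U ^ mers (suc k)
one+geom-pow2 T U k U≡ refl = trans (identity (T * geom T (pow2 (suc k))))
  (cong (T *_) (trans (geom-mers T (suc k)) (cong (_^ mers (suc k)) U≡)))
  where
  identity : ∀ f → one + (one + f) ≡ f
  identity = solve-∀ ring

-- For P of length 2^(k+1) + 1 one has 1 + P = T·U^v with v = 2^(k+1) - 1, so the factor (1 + P)^c
-- contributes c to the exponent of T and v·c to that of U. Unique factorisation gives the rest.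
exponent-equations : ∀ {T U P} → one + T ≡ U → Irreducible T → Irreducible U → Irreducible P → T ≢ U → T ≢ P → U ≢ P →
  ∀ k {a b c e f α β S S′ S″} → P ≡ geom T (suc (pow2 (suc k))) →
  S ≡ U ^ e * P ^ α → S′ ≡ T ^ f * P ^ β → S″ ≡ (one + P) ^ c →
  T ^ a * (U ^ b * (P ^ c * one)) ≡ S * (S′ * (S″ * one)) →
  a ≡ f ℕ.+ c × b ≡ e ℕ.+ mers (suc k) ℕ.* c × c ≡ α ℕ.+ β
exponent-equations {T} {U} {P} U≡ irrT irrU irrP T≢U T≢P U≢P k {a} {b} {c} {e} {f} {α} {β} P≡ refl refl refl eq =
  exponents-unique irrT irrU irrP T≢U T≢P U≢P a b c (f ℕ.+ c) (e ℕ.+ v ℕ.* c) (α ℕ.+ β) (begin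
    T ^ a * (U ^ b * (P ^ c * one))                                        ≡⟨ eq ⟩
    U ^ e * P ^ α * (T ^ f * P ^ β * ((one + P) ^ c * one))                ≡⟨ cong (λ z → U ^ e * P ^ α * (T ^ f * P ^ β * (z * one))) power ⟩
    U ^ e * P ^ α * (T ^ f * P ^ β * (T ^ c * U ^ (v ℕ.* c) * one))        ≡⟨ regroup (U ^ e) (P ^ α) (T ^ f) (P ^ β) (T ^ c) (U ^ (v ℕ.* c)) ⟩
    T ^ f * T ^ c * (U ^ e * U ^ (v ℕ.* c) * (P ^ α * P ^ β * one))        ≡⟨ cong₂ (λ x y → x * (y * (P ^ α * P ^ β * one))) (^-+ T f c) (^-+ U e (v ℕ.* c)) ⟨
    T ^ (f ℕ.+ c) * (U ^ (e ℕ.+ v ℕ.* c) * (P ^ α * P ^ β * one))          ≡⟨ cong (λ x → T ^ (f ℕ.+ c) * (U ^ (e ℕ.+ v ℕ.* c) * (x * one))) (^-+ P α β) ⟨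
    T ^ (f ℕ.+ c) * (U ^ (e ℕ.+ v ℕ.* c) * (P ^ (α ℕ.+ β) * one))          ∎)
  where
  open ≡-Reasoning
  v : ℕ
  v = mers (suc k)
  power : (one + P) ^ c ≡ T ^ c * U ^ (v ℕ.* c)
  power = trans (cong (_^ c) (one+geom-pow2 T U k U≡ P≡)) (trans (^-distrib-* T (U ^ v) c) (cong (T ^ c *_) (sym (^-* U v c))))
  regroup : ∀ u p t p′ t′ u′ → u * p * (t * p′ * (t′ * u′ * one)) ≡ t * t′ * (u * u′ * (p * p′ * one))
  regroup = solve-∀ ring

-- 1 + P equals both T·U^v and U·T^w, which forces v = w = 1.
both-mixed : ∀ {T U P} → one + T ≡ U → one + U ≡ T → Irreducible T → Irreducible U → T ≢ U →
             ∀ k l → P ≡ geom T (suc (pow2 (suc k))) → P ≡ geom U (suc (pow2 (suc l))) → k ≡ 0 × l ≡ 0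
both-mixed {T} {U} U≡ T≡ irrT irrU T≢U k l P≡ P≡′ = mers-zero k (sym v≡1) , mers-zero l (sym 1≡v)
  where
  T∤U^ : ∀ n → ¬ T ≼ U ^ n
  T∤U^ n = irreducible∤^ n irrT irrU T≢U
  U≡U^1 : U ≡ U ^ 1
  U≡U^1 = sym (*-identityʳ U)
  same : T ^ 1 * U ^ mers (suc k) ≡ T ^ mers (suc l) * U ^ 1
  same = trans (cong (_* U ^ mers (suc k)) (*-identityʳ T)) (trans (trans (sym (one+geom-pow2 T U k U≡ P≡)) (one+geom-pow2 U T l T≡ P≡′))
    (trans (*-comm U (T ^ mers (suc l))) (cong (T ^ mers (suc l) *_) U≡U^1)))
  split : 1 ≡ mers (suc l) × U ^ mers (suc k) ≡ U ^ 1
  split = Valuation.split-unique irrT 1 (mers (suc l)) (T∤U^ (mers (suc k))) (T∤U^ 1) same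
  1≡v : 1 ≡ mers (suc l)
  1≡v = proj₁ split
  v≡1 : 1 ≡ mers (suc k)
  v≡1 = sym (proj₁ (Valuation.split-unique irrU (mers (suc k)) 1 (irreducible∤one irrU) (irreducible∤one irrU) (cong (_* one) (proj₂ split))))
  mers-zero : ∀ k → mers (suc k) ≡ 1 → k ≡ 0
  mers-zero zero    _ = refl
  mers-zero (suc k) ()

-- Linear polynomials

linear-irreducible : ∀ {T} → size T ≡ 2 → Irreducible T
linear-irreducible {T} s = T≢𝟎 , (λ e → ℕ.0≢1+n (ℕ.suc-injective (trans (cong size (sym e)) s))) , trivial
  where
  T≢𝟎 : T ≢ 𝟎
  T≢𝟎 e = ℕ.0≢1+n (trans (cong size (sym e)) s)
  trivial : ∀ D → D ∣ T → D ≡ one ⊎ D ≡ T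
  trivial D (Q , e) with Q ≟ one
  ... | yes refl = inj₂ (trans (sym (*-identityʳ D)) e)
  ... | no Q≢1   = inj₁ (size-≡1 D≢𝟎 (ℕ.≤-pred (subst (size D <_) (trans (cong size e) s)
    (size-factorˡ-< D≢𝟎 (nonzero-factorʳ {D} e T≢𝟎) Q≢1))))
    where
    D≢𝟎 : D ≢ 𝟎
    D≢𝟎 = nonzero-factorˡ e T≢𝟎

-- The remainder modulo a linear polynomial is zero or one. Thus divisibility of A by 1 + P, for any
-- prime P of A, passes on to X and X + 1.
linear-∣ : ∀ {T} → size T ≡ 2 → ∀ f → T ≼ f ⊎ T ≼ one + f
linear-∣ {⟨ p ⟩} s f with divMod p f
... | q , r , e , sr with r ≟ 𝟎
...   | yes refl = inj₁ (divides q (trans (sym (+-identityʳ _)) (sym e)))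
...   | no r≢0 with refl ← size-≡1 r≢0 (subst (size r ≤_) (ℕ.suc-injective s) sr) =
  inj₂ (divides q (trans (identity (⟨ p ⟩ * q)) (cong (one +_) (sym e))))
  where
  identity : ∀ g → g ≡ one + (g + one)
  identity = solve-∀ ring

-- Reduction to the primes X, X + 1 and one more

perfect-one+∣ : ∀ {A P Q R} → Irreducible P → Irreducible Q → Irreducible R → P ≢ Q → P ≢ R → Q ≢ R →
                BiUnitaryPerfect A → P ≼ A → Q ≼ A → R ≼ A →
                (∀ S → Irreducible S → S ≼ A → S ≡ P ⊎ S ≡ Q ⊎ S ≡ R) → one + P ≼ A
perfect-one+∣ {P = P} irrP irrQ irrR P≢Q P≢R Q≢R (A≢0 , σ) P∣A Q∣A R∣A only
  with a , b , c , refl ← factorisation irrP irrQ irrR P≢Q P≢R Q≢R A≢0 P∣A Q∣A R∣A only =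
  subst (one + P ≼_) (sym (σ-product irrP irrQ irrR P≢Q P≢R Q≢R a b c (parity (suc a)) (parity (suc b)) (parity (suc c)) σ))
    (≼-*ʳ _ (one+∣σ^ P (parity (suc a))))

third : ∀ {A : Set} {p q r x y : A} → Unique (p ∷ q ∷ r ∷ []) → x ∈ p ∷ q ∷ r ∷ [] → y ∈ p ∷ q ∷ r ∷ [] → x ≢ y →
        ∃ λ z → z ∈ p ∷ q ∷ r ∷ [] × x ≢ z × y ≢ z × (∀ s → s ∈ p ∷ q ∷ r ∷ [] → s ≡ x ⊎ s ≡ y ⊎ s ≡ z)
third {A} {p} {q} {r} ((p≢q ∷ p≢r ∷ []) ∷ (q≢r ∷ []) ∷ [] ∷ []) = choose
  where
  among : ∀ {x y z : A} → (p ≡ x ⊎ p ≡ y ⊎ p ≡ z) → (q ≡ x ⊎ q ≡ y ⊎ q ≡ z) → (r ≡ x ⊎ r ≡ y ⊎ r ≡ z) →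
          ∀ s → s ∈ p ∷ q ∷ r ∷ [] → s ≡ x ⊎ s ≡ y ⊎ s ≡ z
  among hp hq hr s (here refl)                 = hp
  among hp hq hr s (there (here refl))         = hq
  among hp hq hr s (there (there (here refl))) = hr
  choose : ∀ {x y} → x ∈ p ∷ q ∷ r ∷ [] → y ∈ p ∷ q ∷ r ∷ [] → x ≢ y →
           ∃ λ z → z ∈ p ∷ q ∷ r ∷ [] × x ≢ z × y ≢ z × (∀ s → s ∈ p ∷ q ∷ r ∷ [] → s ≡ x ⊎ s ≡ y ⊎ s ≡ z)
  choose (here refl) (here refl) x≢y = ⊥-elim (x≢y refl)
  choose (here refl) (there (here refl)) _ = r , there (there (here refl)) , p≢r , q≢r , among (inj₁ refl) (inj₂ (inj₁ refl)) (inj₂ (inj₂ refl))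
  choose (here refl) (there (there (here refl))) _ = q , there (here refl) , p≢q , (λ e → q≢r (sym e)) , among (inj₁ refl) (inj₂ (inj₂ refl)) (inj₂ (inj₁ refl))
  choose (there (here refl)) (here refl) _ = r , there (there (here refl)) , q≢r , p≢r , among (inj₂ (inj₁ refl)) (inj₁ refl) (inj₂ (inj₂ refl))
  choose (there (here refl)) (there (here refl)) x≢y = ⊥-elim (x≢y refl)
  choose (there (here refl)) (there (there (here refl))) _ = p , here refl , (λ e → p≢q (sym e)) , (λ e → p≢r (sym e)) , among (inj₂ (inj₂ refl)) (inj₁ refl) (inj₂ (inj₁ refl))
  choose (there (there (here refl))) (here refl) _ = q , there (here refl) , (λ e → q≢r (sym e)) , p≢q , among (inj₂ (inj₁ refl)) (inj₂ (inj₂ refl)) (inj₁ refl)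
  choose (there (there (here refl))) (there (here refl)) _ = p , here refl , (λ e → p≢r (sym e)) , (λ e → p≢q (sym e)) , among (inj₂ (inj₂ refl)) (inj₂ (inj₁ refl)) (inj₁ refl)
  choose (there (there (here refl))) (there (there (here refl))) x≢y = ⊥-elim (x≢y refl)

-- Classification of A = X^a (X+1)^b P^c

Good : Poly → Set
Good A = A ∈ Cs ⊎ bar A ∈ Cs

module Classification {A P : Poly} (irrP : Irreducible P) (X≢P : X ≢ P) (Y≢P : X+1 ≢ P) (a b c : ℕ)
  (A≡ : A ≡ X ^ suc a * (X+1 ^ suc b * (P ^ suc c * one)))
  (σ≡ : A ≡ σ^ X (parity (suc a)) * (σ^ X+1 (parity (suc b)) * (σ^ P (parity (suc c)) * one))) where

  irrX : Irreducible X
  irrX = linear-irreducible {X} refl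

  irrY : Irreducible X+1
  irrY = linear-irreducible {X+1} refl

  X≢Y : X ≢ X+1
  X≢Y ()

  Y≢X : X+1 ≢ X
  Y≢X ()

  swap : ∀ x y z → x * (y * z) ≡ y * (x * z)
  swap = solve-∀ ring

  A≡′ : A ≡ X+1 ^ suc b * (X ^ suc a * (P ^ suc c * one))
  A≡′ = trans A≡ (swap (X ^ suc a) (X+1 ^ suc b) (P ^ suc c * one))

  σX σY σP : Poly
  σX = σ^ X (parity (suc a))
  σY = σ^ X+1 (parity (suc b))
  σP = σ^ P (parity (suc c))

  σX∣A : σX ≼ A
  σX∣A = divides _ (sym σ≡)

  σY∣A : σY ≼ A
  σY∣A = subst (σY ≼_) (sym σ≡) (≼-*ˡ σX (divides _ refl))

  σP∣A : σP ≼ A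
  σP∣A = subst (σP ≼_) (sym σ≡) (≼-*ˡ σX (≼-*ˡ σY (divides _ refl)))

  one+P∣A : one + P ≼ A
  one+P∣A = ≼-trans (one+∣σ^ P (parity (suc c))) σP∣A

  smooth : ∀ {f} → f ≼ A → Smooth X X+1 P f
  smooth f∣A = divisor-form irrX irrY irrP X≢Y X≢P Y≢P (suc a) (suc b) (suc c) (subst (_ ≼_) A≡ f∣A)

  smooth′ : ∀ {f} → f ≼ A → Smooth X+1 X P f
  smooth′ f∣A = divisor-form irrY irrX irrP Y≢X Y≢P X≢P (suc b) (suc a) (suc c) (subst (_ ≼_) A≡′ f∣A)

  module SideX = Side {X} {X+1} {P} refl refl irrX irrY irrP X≢Y X≢P Y≢P (smooth one+P∣A)
  module SideY = Side {X+1} {X} {P} refl refl irrY irrX irrP Y≢X Y≢P X≢P (smooth′ one+P∣A)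

  linear∣one+P : ∀ {T} → Irreducible T → size T ≡ 2 → T ≢ P → T ≼ one + P
  linear∣one+P irrT s T≢P = [ (λ T∣P → ⊥-elim (T≢P (irreducible-∣ irrT irrP T∣P))) , (λ d → d) ]′ (linear-∣ s P)

  shape-P : Pure (suc c) × σP ≡ (one + P) ^ suc c
  shape-P = SideX.σ-shape-P (linear∣one+P irrX refl X≢P) (linear∣one+P irrY refl Y≢P) (parity (suc c)) (s≤s z≤n) (smooth σP∣A)

  shape-X : SideX.Shape (suc a) σX
  shape-X = SideX.σ-shape (parity (suc a)) (s≤s z≤n) (smooth σX∣A)

  shape-Y : SideY.Shape (suc b) σY
  shape-Y = SideY.σ-shape (parity (suc b)) (s≤s z≤n) (smooth′ σY∣A)

  -- Otherwise no factor of σ**(A) would be divisible by P, although P divides A.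
  no-mixed : σX ≡ X+1 ^ suc a → σY ≡ X ^ suc b → ⊥
  no-mixed eX eY = V.∤-* P∤σX (V.∤-* P∤σY (V.∤-* P∤σP (irreducible∤one irrP)))
    (subst (P ≼_) (trans (sym A≡) σ≡) (≼-*ˡ (X ^ suc a) (≼-*ˡ (X+1 ^ suc b) (≼-*ʳ one (divides (P ^ c) refl)))))
    where
    module V = Valuation irrP
    P∤σX : ¬ P ≼ σX
    P∤σX d = irreducible∤^ (suc a) irrP irrY (λ e → Y≢P (sym e)) (subst (P ≼_) eX d)
    P∤σY : ¬ P ≼ σY
    P∤σY d = irreducible∤^ (suc b) irrP irrX (λ e → X≢P (sym e)) (subst (P ≼_) eY d)
    P∤σP : ¬ P ≼ σP
    P∤σP d = SideX.P∤one+P (euclid-^ (one + P) (suc c) irrP (subst (P ≼_) (proj₂ shape-P) d))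

  -- k = 0 gives P = M₁ for both choices of T; k = 1 gives M₄ for T = X and M₅ for T = X + 1.
  shape-small : ∀ {T} k → size T ≡ 2 → P ≡ geom T (suc (pow2 (suc k))) → k ≡ 0 ⊎ k ≡ 1
  shape-small zero          _ _  = inj₁ refl
  shape-small (suc zero)    _ _  = inj₂ refl
  shape-small (suc (suc k)) s P≡ = ⊥-elim (Trace.large-reducible s k (subst Irreducible P≡ irrP))

  -- With numerals for the exponents and a closed P′ the polynomial can be evaluated, so membership
  -- in `Cs`, also after `bar`, is settled by `refl`.
  by : ∀ {a′ b′ c′ P′} → suc a ≡ a′ → suc b ≡ b′ → suc c ≡ c′ → P ≡ P′ →
       Good (X ^ a′ * (X+1 ^ b′ * (P′ ^ c′ * one))) → Good A
  by refl refl refl refl good = subst Good (sym A≡) good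

  -- In C₁, C₂, C₆ and C₇ the mixed prime is X + 1. A mixed X therefore yields their conjugates, and
  -- `one-mixed-Y` the polynomials themselves.
  one-mixed-X : ∀ k → P ≡ geom X (suc (pow2 (suc k))) → k ≡ 0 ⊎ k ≡ 1 →
                suc a ≡ suc b ℕ.+ suc c → suc b ≡ mers (suc (suc k)) × (suc c ≡ 1 ⊎ suc c ≡ 2) → Good A
  one-mixed-X .0 P≡ (inj₁ refl) a≡ (b≡ , inj₁ c≡) = by (trans a≡ (cong₂ ℕ._+_ b≡ c≡)) b≡ c≡ P≡ (inj₂ (here refl))
  one-mixed-X .0 P≡ (inj₁ refl) a≡ (b≡ , inj₂ c≡) = by (trans a≡ (cong₂ ℕ._+_ b≡ c≡)) b≡ c≡ P≡ (inj₂ (there (here refl)))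
  one-mixed-X .1 P≡ (inj₂ refl) a≡ (b≡ , inj₁ c≡) = by (trans a≡ (cong₂ ℕ._+_ b≡ c≡)) b≡ c≡ P≡ (inj₂ (there (there (there (there (there (here refl)))))))
  one-mixed-X .1 P≡ (inj₂ refl) a≡ (b≡ , inj₂ c≡) = by (trans a≡ (cong₂ ℕ._+_ b≡ c≡)) b≡ c≡ P≡ (inj₂ (there (there (there (there (there (there (here refl))))))))

  one-mixed-Y : ∀ k → P ≡ geom X+1 (suc (pow2 (suc k))) → k ≡ 0 ⊎ k ≡ 1 →
                suc b ≡ suc a ℕ.+ suc c → suc a ≡ mers (suc (suc k)) × (suc c ≡ 1 ⊎ suc c ≡ 2) → Good A
  one-mixed-Y .0 P≡ (inj₁ refl) b≡ (a≡ , inj₁ c≡) = by a≡ (trans b≡ (cong₂ ℕ._+_ a≡ c≡)) c≡ P≡ (inj₁ (here refl))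
  one-mixed-Y .0 P≡ (inj₁ refl) b≡ (a≡ , inj₂ c≡) = by a≡ (trans b≡ (cong₂ ℕ._+_ a≡ c≡)) c≡ P≡ (inj₁ (there (here refl)))
  one-mixed-Y .1 P≡ (inj₂ refl) b≡ (a≡ , inj₁ c≡) = by a≡ (trans b≡ (cong₂ ℕ._+_ a≡ c≡)) c≡ P≡ (inj₁ (there (there (there (there (there (here refl)))))))
  one-mixed-Y .1 P≡ (inj₂ refl) b≡ (a≡ , inj₂ c≡) = by a≡ (trans b≡ (cong₂ ℕ._+_ a≡ c≡)) c≡ P≡ (inj₁ (there (there (there (there (there (there (here refl))))))))

  two-mixed-XY : ∀ {a′ b′ c′} → P ≡ geom X 3 → suc a ≡ a′ → suc b ≡ b′ → suc c ≡ c′ → TwoMixed a′ b′ c′ → Good A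
  two-mixed-XY P≡ a≡ b≡ c≡ ⟨4,4,2⟩ = by a≡ b≡ c≡ P≡ (inj₁ (there (there (here refl))))
  two-mixed-XY P≡ a≡ b≡ c≡ ⟨6,6,2⟩ = by a≡ b≡ c≡ P≡ (inj₁ (there (there (there (here refl)))))
  two-mixed-XY P≡ a≡ b≡ c≡ ⟨5,4,3⟩ = by a≡ b≡ c≡ P≡ (inj₂ (there (there (there (there (here refl))))))
  two-mixed-XY P≡ a≡ b≡ c≡ ⟨4,5,3⟩ = by a≡ b≡ c≡ P≡ (inj₁ (there (there (there (there (here refl))))))

  classify-mixed : ∀ {k l e f α β} →
    P ≡ geom X (suc (pow2 (suc k))) → Mixed k (suc a) e α → σX ≡ X+1 ^ e * P ^ α →
    P ≡ geom X+1 (suc (pow2 (suc l))) → Mixed l (suc b) f β → σY ≡ X ^ f * P ^ β → k ≡ 0 × l ≡ 0 → Good A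
  classify-mixed {e = e} {f} {α} {β} P≡ m eX P≡′ m′ eY (refl , refl) = conclude (exponent-equations {X} {X+1} refl irrX irrY irrP X≢Y X≢P Y≢P 0 {α = α} {β}
    P≡ eX eY (proj₂ shape-P) (trans (sym A≡) σ≡))
    where
    conclude : suc a ≡ f ℕ.+ suc c × suc b ≡ e ℕ.+ 1 ℕ.* suc c × suc c ≡ α ℕ.+ β → Good A
    conclude (a≡ , b≡ , c≡) = two-mixed-XY P≡ refl refl refl (two-mixed m m′ (proj₁ shape-P) a≡
      (trans b≡ (cong (e ℕ.+_) (ℕ.*-identityˡ (suc c)))) c≡)

  classify : SideX.Shape (suc a) σX → SideY.Shape (suc b) σY → Good A
  classify (inj₁ (_ , eX)) (inj₁ (_ , eY)) = ⊥-elim (no-mixed eX eY)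
  -- A pure factor σ**(U^b) = T^b is the instance f = b, β = 0 of the exponent equations.
  classify (inj₂ (k , e , α , P≡ , m , eX)) (inj₁ (pb , eY)) = conclude (exponent-equations {X} {X+1} refl irrX irrY irrP X≢Y X≢P Y≢P k {f = suc b} {β = 0}
    P≡ eX (trans eY (sym (*-identityʳ (X ^ suc b)))) (proj₂ shape-P) (trans (sym A≡) σ≡))
    where
    conclude : suc a ≡ suc b ℕ.+ suc c × suc b ≡ e ℕ.+ mers (suc k) ℕ.* suc c × suc c ≡ α ℕ.+ 0 → Good A
    conclude (a≡ , b≡ , c≡) = one-mixed-X k P≡ (shape-small {X} k refl P≡) a≡
      (one-mixed m pb (proj₁ shape-P) b≡ (trans c≡ (ℕ.+-identityʳ α)))
  classify (inj₁ (pa , eX)) (inj₂ (l , f , β , P≡ , m , eY)) = conclude (exponent-equations {X+1} {X} refl irrY irrX irrP Y≢X Y≢P X≢P l {f = suc a} {β = 0}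
    P≡ eY (trans eX (sym (*-identityʳ (X+1 ^ suc a)))) (proj₂ shape-P) (trans (sym A≡′) (trans σ≡ (swap σX σY (σP * one)))))
    where
    conclude : suc b ≡ suc a ℕ.+ suc c × suc a ≡ f ℕ.+ mers (suc l) ℕ.* suc c × suc c ≡ β ℕ.+ 0 → Good A
    conclude (b≡ , a≡ , c≡) = one-mixed-Y l P≡ (shape-small {X+1} l refl P≡) b≡
      (one-mixed m pa (proj₁ shape-P) a≡ (trans c≡ (ℕ.+-identityʳ β)))
  classify (inj₂ (k , e , α , P≡ , m , eX)) (inj₂ (l , f , β , P≡′ , m′ , eY)) =
    classify-mixed P≡ m eX P≡′ m′ eY (both-mixed {X} {X+1} refl refl irrX irrY X≢Y k l P≡ P≡′)

  good : Good A
  good = classify shape-X shape-Y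

perfect-with-primes : ∀ {A P} → BiUnitaryPerfect A → Irreducible P → X ≢ P → X+1 ≢ P →
                      X ≼ A → X+1 ≼ A → P ≼ A →
                      (∀ S → Irreducible S → S ≼ A → S ≡ X ⊎ S ≡ X+1 ⊎ S ≡ P) → Good A
perfect-with-primes {A} {P} (A≢0 , σ) irrP X≢P Y≢P X∣A Y∣A P∣A only =
  conclude (factorisation irrX irrY irrP (λ ()) X≢P Y≢P A≢0 X∣A Y∣A P∣A only)
  where
  irrX : Irreducible X
  irrX = linear-irreducible {X} refl
  irrY : Irreducible X+1
  irrY = linear-irreducible {X+1} refl
  conclude : (∃ λ a → ∃₂ λ b c → A ≡ X ^ suc a * (X+1 ^ suc b * (P ^ suc c * one))) → Good A
  conclude (a , b , c , A≡) = Classification.good irrP X≢P Y≢P a b c A≡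
    (σ-product irrX irrY irrP (λ ()) X≢P Y≢P a b c (parity (suc a)) (parity (suc b)) (parity (suc c)) (subst (λ z → SigmaBU≡ z A) A≡ σ))

theorem1p1 : (A : Poly) → BiUnitaryPerfect A → Omega≡ A 3 → (A ∈ Cs) ⊎ (bar A ∈ Cs)
theorem1p1 A perfect (P ∷ Q ∷ R ∷ [] , unique@((P≢Q ∷ P≢R ∷ []) ∷ (Q≢R ∷ []) ∷ _) , ∈L⇔ , refl) =
  conclude (third unique (∈L X irrX X∣A) (∈L X+1 irrY Y∣A) (λ ()))
  where
  L : List Poly
  L = P ∷ Q ∷ R ∷ []
  irrX : Irreducible X
  irrX = linear-irreducible {X} refl
  irrY : Irreducible X+1
  irrY = linear-irreducible {X+1} refl
  irreducible : ∀ S → S ∈ L → Irreducible S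
  irreducible S S∈L = proj₁ (Equivalence.to (∈L⇔ S) S∈L)
  divisor : ∀ S → S ∈ L → S ≼ A
  divisor S S∈L = ∣⇒≼ {S} (proj₂ (Equivalence.to (∈L⇔ S) S∈L))
  ∈L : ∀ S → Irreducible S → S ≼ A → S ∈ L
  ∈L S irr S∣A = Equivalence.from (∈L⇔ S) (irr , ≼⇒∣ S∣A)
  one-of : ∀ {S} → S ∈ L → S ≡ P ⊎ S ≡ Q ⊎ S ≡ R
  one-of (here e)                 = inj₁ e
  one-of (there (here e))         = inj₂ (inj₁ e)
  one-of (there (there (here e))) = inj₂ (inj₂ e)
  irrP : Irreducible P
  irrP = irreducible P (here refl)
  one+P∣A : one + P ≼ A
  one+P∣A = perfect-one+∣ irrP (irreducible Q (there (here refl))) (irreducible R (there (there (here refl)))) P≢Q P≢R Q≢R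
    perfect (divisor P (here refl)) (divisor Q (there (here refl))) (divisor R (there (there (here refl))))
    (λ S irr S∣A → one-of (∈L S irr S∣A))
  -- The listed prime P need not be linear. Still, T divides P or 1 + P, and both divide A.
  linear∣A : ∀ {T} → size T ≡ 2 → T ≼ A
  linear∣A s = [ (λ T∣P → subst (_≼ A) (sym (irreducible-∣ (linear-irreducible s) irrP T∣P)) (divisor P (here refl)))
               , (λ T∣one+P → ≼-trans T∣one+P one+P∣A) ]′ (linear-∣ s P)
  X∣A : X ≼ A
  X∣A = linear∣A refl
  Y∣A : X+1 ≼ A
  Y∣A = linear∣A refl
  conclude : (∃ λ Z → Z ∈ L × X ≢ Z × X+1 ≢ Z × (∀ S → S ∈ L → S ≡ X ⊎ S ≡ X+1 ⊎ S ≡ Z)) → Good A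
  conclude (Z , Z∈L , X≢Z , Y≢Z , all) = perfect-with-primes perfect (irreducible Z Z∈L) X≢Z Y≢Z X∣A Y∣A (divisor Z Z∈L)
    (λ S irr S∣A → all S (∈L S irr S∣A))
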